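{- For every positive integer $n$, \[ \mathrm{sat}_4(n, B_4) = \begin{cases} \binom{n}{4} & \text{if } n \le 6,\\ n & \text{if } n \in \{7, 8\},\\ n - 3 & \text{if } n \ge 9. \end{cases} \]
   Context: A $4$-uniform hypergraph on vertex set $V$ is a set of $4$-element subsets (hyperedges) of $V$. The bow tie $B_4$ is the $4$-uniform hypergraph on $7$ vertices consisting of two hyperedges sharing exactly one vertex; a hypergraph is $B_4$-free if no two of its hyperedges intersect in exactly one vertex. A $4$-uniform hypergraph $G$ on $n$ vertices is $B_4$-saturated if it is $B_4$-free and for every $4$-subset $S$ of $V(G)$ that is not a hyperedge of $G$, adding $S$ as a hyperedge creates a copy of $B_4$, i.e. there is a hyperedge $A$ of $G$ with $|A \cap S| = 1$. $\mathrm{sat}_4(n, B_4)$ denotes the minimum number of hyperedges of an $n$-vertex $4$-uniform $B_4$-saturated hypergraph. -}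

module Defs where

open import Data.Nat using (ℕ; _≤_; _≥_; _∸_)
open import Data.Nat.Combinatorics using (_C_)
open import Data.Fin.Subset using (Subset; ∣_∣; _∩_)
open import Data.List using (List; length)
open import Data.List.Membership.Propositional using (_∈_)
open import Data.List.Relation.Unary.All using (All)
open import Data.List.Relation.Unary.Any using (Any)
open import Data.List.Relation.Unary.Unique.Propositional using (Unique)
open import Data.Product using (_×_; Σ-syntax)
open import Relation.Binary.PropositionalEquality using (_≡_; _≢_)
open import Relation.Nullary using (¬_)

Is4Set : ∀ {n} → Subset n → Set
Is4Set S = ∣ S ∣ ≡ 4

record Hypergraph4 (n : ℕ) : Set where
  constructor mkHG
  field
    edges   : List (Subset n)
    uniform : All Is4Set edges
    noDup   : Unique edges
open Hypergraph4 public

e : ∀ {n} → Hypergraph4 n → ℕ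
e G = length (edges G)

B4Free : ∀ {n} → Hypergraph4 n → Set
B4Free G = ∀ A B → A ∈ edges G → B ∈ edges G → ∣ A ∩ B ∣ ≢ 1

B4Saturated : ∀ {n} → Hypergraph4 n → Set
B4Saturated {n} G =
  B4Free G ×
  (∀ (S : Subset n) → Is4Set S → ¬ (S ∈ edges G) →
     Any (λ A → ∣ A ∩ S ∣ ≡ 1) (edges G))

IsSat4B4 : ℕ → ℕ → Set
IsSat4B4 n m =
  (Σ[ G ∈ Hypergraph4 n ] (B4Saturated G × e G ≡ m)) ×
  (∀ (G : Hypergraph4 n) → B4Saturated G → m ≤ e G)

{- A 4-set is blocked if some edge meets it in exactly one vertex; saturation says that the blocked 4-sets are
   exactly the non-edges. Call two covered vertices twins if no edge separates them.

   Lower bound for n ≥ 9. Two disjoint twin pairs always form an edge. Let X be a set of vertices together with a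
   set F of edges inside X such that F covers X and separates all vertices of X that have no twin in X. An edge
   leaving X meets it in three vertices, and its fourth vertex joins X at the cost of one edge, or in a twin pair
   p, q; then it is pqxy, and either xy is a twin pair, which forms edges with two pairs of X, or some z makes
   pqxz and pqyz edges. So |F| - |X| never decreases. In a component without twins a finite search yields such an
   X with |X| ≤ |F|: as long as X is not found, some 4-set is unblocked or two vertices are unseparated, and one
   branches over the traces of the edge that must exist. Starting from nothing, from pqxy, pqxz, pqyz, or from two
   twin pairs, the deficit |X| - |F| is 0, 2 or 3. Without twins at most three vertices are uncovered, with twins
   at most one, and an uncovered vertex forces a start of deficit 2. For n = 7 and n = 8 the same search shows
   directly that there are n edges.

   Upper bound. Small explicit hypergraphs serve up to n = 12; beyond, a single edge and the Fano complement are
   enlarged by edges K ∪ {x}, where K is a line of the Fano plane and x runs through the new vertices. -}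

module Submission where

open import Defs
open import Data.Bool using (Bool; true; false; _∧_)
import Data.Bool as Bool
open import Data.Bool.Properties using (∧-zeroʳ; ∧-identityʳ)
open import Data.Empty using (⊥; ⊥-elim)
open import Data.Fin using (Fin; zero; suc; #_)
import Data.Fin.Properties as Fin
open import Data.Fin.Subset using (Subset; ∣_∣; _∩_; ⊤; ⁅_⁆) renaming (⊥ to ∅; _∈_ to _∈ˢ_)
open import Data.Fin.Subset.Properties
  using (∣p∩q∣≤∣p∣; ∩-identityʳ; ∩-zeroˡ; ∩-zeroʳ; ∩-idem; ∩-comm; ∣⊤∣≡n; ∣⊥∣≡0; ∣⁅x⁆∣≡1; ∣p∣≤n; x∈⁅x⁆;
    x∈⁅y⁆⇒x≡y)
open import Data.List using (List; []; _∷_; _++_; length; allFin)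
import Data.List as List
import Data.List.Properties as List
import Data.List.Membership.DecPropositional as Membership
open import Data.List.Membership.Propositional using (_∈_; _∉_; find; lose)
open import Data.List.Membership.Propositional.Properties
  using (∈-lookup; ∈-++⁺ˡ; ∈-++⁺ʳ; ∈-map⁺; ∈-map⁻; ∈-allFin)
open import Data.List.Relation.Unary.All using (All; []; _∷_)
import Data.List.Relation.Unary.All as All
import Data.List.Relation.Unary.All.Properties as All
open import Data.List.Relation.Unary.AllPairs using (AllPairs; []; _∷_)
import Data.List.Relation.Unary.AllPairs as AllPairs
import Data.List.Relation.Unary.AllPairs.Properties as AllPairs
open import Data.List.Relation.Unary.Any using (Any; here; there)
import Data.List.Relation.Unary.Any as Any
import Data.List.Relation.Unary.Any.Properties as Any
open import Data.List.Relation.Unary.Unique.DecPropositional using (unique?)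
open import Data.List.Relation.Unary.Unique.Propositional using () renaming (Unique to Uniqueᴸ)
import Data.List.Relation.Unary.Unique.Propositional.Properties as Uniqueᴸ
import Data.Maybe.Relation.Unary.Any as Maybe
open import Data.Nat using (ℕ; zero; suc; _+_; _∸_; _^_; _≤_; _<_; _≥_; z≤n; s≤s; NonZero)
open import Data.Nat.DivMod using (_/_; _%_; _mod_)
open import Data.Nat.Properties
open import Data.Product using (_×_; _,_; proj₁; proj₂; ∃-syntax; Σ-syntax)
open import Data.Sum using (_⊎_; inj₁; inj₂)
open import Data.Unit using (tt) renaming (⊤ to Unit)
open import Data.Vec using (Vec; []; _∷_; lookup; map; splitAt; _[_]≔_) renaming (_++_ to _++ⱽ_)
open import Data.Vec.Properties
  using (lookup∘update; lookup∘update′; lookup-replicate; lookup-zipWith; lookup-map; tabulate∘lookup;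
    tabulate-cong; map-cong; map-∘; ≡-dec; zipWith-++; ++-injectiveˡ; ++-injectiveʳ)
open import Data.Vec.Relation.Unary.All using ([]; _∷_) renaming (All to Allⱽ)
import Data.Vec.Relation.Unary.All as Allⱽ
import Data.Vec.Relation.Unary.All.Properties as Allⱽ
open import Data.Vec.Relation.Unary.AllPairs using ([]; _∷_; allPairs?)
open import Data.Vec.Relation.Unary.Unique.Propositional using (Unique)
import Data.Vec.Relation.Unary.Unique.Propositional.Properties as Unique
open import Function using (_∘_; id)
open import Relation.Binary.PropositionalEquality
open import Relation.Nullary using (¬_; Dec; yes; no; contradiction)
open import Relation.Nullary.Decidable
  using (_×-dec_; _⊎-dec_; _→-dec_; ¬?; map′; True; toWitness; fromWitness; from-yes)

private variable
  n k m t : ℕ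

-- Traces of vertex sets on labels and images of label sets

subset-ext : (A B : Subset n) → (∀ v → lookup A v ≡ lookup B v) → A ≡ B
subset-ext A B eq =
  trans (sym (tabulate∘lookup A)) (trans (tabulate-cong eq) (tabulate∘lookup B))

trace : Vec (Fin n) k → Subset n → Subset k
trace φ A = map (lookup A) φ

image : Vec (Fin n) k → Subset k → Subset n
image []      []      = ∅
image (v ∷ φ) (b ∷ S) = image φ S [ v ]≔ b

Fresh : Fin n → Vec (Fin n) k → Set
Fresh v φ = Allⱽ (v ≢_) φ

fresh? : (v : Fin n) (φ : Vec (Fin n) k) → Dec (Fresh v φ)
fresh? v = Allⱽ.all? (λ w → ¬? (v Fin.≟ w))

not-fresh : ∀ {v} (φ : Vec (Fin n) k) → ¬ Fresh v φ → ∃[ i ] lookup φ i ≡ v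
not-fresh []      v∈φ = contradiction [] v∈φ
not-fresh {v = v} (w ∷ φ) v∈φ with v Fin.≟ w
... | yes refl = zero , refl
... | no  v≢w  = let i , eq = not-fresh φ (v∈φ ∘ (v≢w ∷_)) in suc i , eq

-- Prepending the membership bit of `v` adds 0 or 1 to the size, which is the form in which `trace`
-- delivers that bit.
∣update∣ : ∀ (A R : Subset n) v → lookup R v ≡ false →
           ∣ A ∩ (R [ v ]≔ true) ∣ ≡ ∣ lookup A v ∷ (A ∩ R) ∣
∣update∣ (true  ∷ A) (false ∷ R) zero    refl = refl
∣update∣ (false ∷ A) (false ∷ R) zero    refl = refl
∣update∣ (a ∷ A)     (r ∷ R)     (suc v) r∌v with a ∧ r | lookup A v | ∣update∣ A R v r∌v
... | false | _     | ih = ih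
... | true  | false | ih = cong suc ih
... | true  | true  | ih = cong suc ih

update-false : ∀ (R : Subset n) v → lookup R v ≡ false → R [ v ]≔ false ≡ R
update-false (false ∷ R) zero    refl = refl
update-false (r ∷ R)     (suc v) r∌v  = cong (r ∷_) (update-false R v r∌v)

image-fresh : ∀ {φ : Vec (Fin n) k} S {v} → Fresh v φ → lookup (image φ S) v ≡ false
image-fresh {φ = []}    []      {v} []       = lookup-replicate v false
image-fresh {φ = w ∷ φ} (b ∷ S) (v≢w ∷ v∉φ) =
  trans (lookup∘update′ v≢w (image φ S) b) (image-fresh S v∉φ)

trace-image : ∀ {φ : Vec (Fin n) k} → Unique φ → ∀ S → trace φ (image φ S) ≡ S
trace-image []              []      = refl
trace-image {φ = v ∷ φ} (v∉φ ∷ uφ) (b ∷ S) =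
  cong₂ _∷_ (lookup∘update v (image φ S) b) (trans (same φ v∉φ) (trace-image uφ S))
  where
  same : ∀ {j} (ψ : Vec (Fin _) j) → Fresh v ψ → trace ψ (image φ S [ v ]≔ b) ≡ trace ψ (image φ S)
  same []      []           = refl
  same (w ∷ ψ) (v≢w ∷ v∉ψ) = cong₂ _∷_ (lookup∘update′ (v≢w ∘ sym) (image φ S) b) (same ψ v∉ψ)

-- The bridge between vertices and labels: `trace` and `image` are adjoint with respect to counting
-- common elements, so whether an edge meets a labelled 4-set in one vertex can be read from its
-- trace alone. One more label changes both sides by the same membership bit.
∣∩image∣ : ∀ {φ : Vec (Fin n) k} → Unique φ → ∀ A S → ∣ A ∩ image φ S ∣ ≡ ∣ trace φ A ∩ S ∣
∣∩image∣ {n} []          A []      = trans (cong ∣_∣ (∩-zeroʳ A)) (∣⊥∣≡0 n)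
∣∩image∣ {φ = v ∷ φ} (v∉φ ∷ uφ) A (false ∷ S)
  rewrite update-false (image φ S) v (image-fresh S v∉φ) | ∧-zeroʳ (lookup A v) = ∣∩image∣ uφ A S
∣∩image∣ {φ = v ∷ φ} (v∉φ ∷ uφ) A (true ∷ S)
  rewrite ∣update∣ A (image φ S) v (image-fresh S v∉φ) | ∧-identityʳ (lookup A v)
  with lookup A v
... | false = ∣∩image∣ uφ A S
... | true  = cong suc (∣∩image∣ uφ A S)

∣image∣ : ∀ {φ : Vec (Fin n) k} → Unique φ → ∀ S → ∣ image φ S ∣ ≡ ∣ S ∣
∣image∣ {φ = φ} uφ S = begin
  ∣ image φ S ∣             ≡⟨ cong ∣_∣ (sym (∩-idem (image φ S))) ⟩
  ∣ image φ S ∩ image φ S ∣ ≡⟨ ∣∩image∣ uφ (image φ S) S ⟩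
  ∣ trace φ (image φ S) ∩ S ∣ ≡⟨ cong (λ T → ∣ T ∩ S ∣) (trace-image uφ S) ⟩
  ∣ S ∩ S ∣                 ≡⟨ cong ∣_∣ (∩-idem S) ⟩
  ∣ S ∣                     ∎
  where open ≡-Reasoning

∣trace∣≤ : ∀ {φ : Vec (Fin n) k} → Unique φ → ∀ A → ∣ trace φ A ∣ ≤ ∣ A ∣
∣trace∣≤ {φ = φ} uφ A = begin
  ∣ trace φ A ∣         ≡⟨ cong ∣_∣ (sym (∩-identityʳ (trace φ A))) ⟩
  ∣ trace φ A ∩ ⊤ ∣     ≡⟨ sym (∣∩image∣ uφ A ⊤) ⟩
  ∣ A ∩ image φ ⊤ ∣     ≤⟨ ∣p∩q∣≤∣p∣ A (image φ ⊤) ⟩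
  ∣ A ∣                 ∎
  where open ≤-Reasoning

-- Labelling one more vertex of `A` would make the trace larger than `A`.
trace-full-fresh : ∀ {φ : Vec (Fin n) k} → Unique φ → ∀ {A} → ∣ trace φ A ∣ ≡ ∣ A ∣ →
                   ∀ {v} → Fresh v φ → lookup A v ≡ false
trace-full-fresh {φ = φ} uφ {A} full {v} v∉φ with lookup A v | ∣trace∣≤ (v∉φ ∷ uφ) A
... | false | _ = refl
... | true  | p = contradiction p (<⇒≱ (≤-reflexive (cong suc (sym full))))

lookup-image : ∀ {φ : Vec (Fin n) k} → Unique φ → ∀ S i → lookup (image φ S) (lookup φ i) ≡ lookup S i
lookup-image {φ = φ} uφ S i =
  trans (sym (lookup-map i (lookup (image φ S)) φ)) (cong (λ T → lookup T i) (trace-image uφ S))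

image-trace : ∀ {φ : Vec (Fin n) k} → Unique φ → ∀ {A} → ∣ trace φ A ∣ ≡ ∣ A ∣ →
              image φ (trace φ A) ≡ A
image-trace {φ = φ} uφ {A} full = subset-ext _ A agree
  where
  agree : ∀ v → lookup (image φ (trace φ A)) v ≡ lookup A v
  agree v with fresh? v φ
  ... | yes v∉φ = trans (image-fresh (trace φ A) v∉φ) (sym (trace-full-fresh uφ {A} full v∉φ))
  ... | no  v∈φ with i , refl ← not-fresh φ v∈φ =
    trans (lookup-image uφ (trace φ A) i) (lookup-map i (lookup A) φ)

-- Otherwise `A` would lie among the labelled vertices, and its trace would be as large as `A`.
fresh-element : ∀ {φ : Vec (Fin n) k} → Unique φ → ∀ {A} → ∣ trace φ A ∣ < ∣ A ∣ →
                ∃[ v ] Fresh v φ × lookup A v ≡ true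
fresh-element {φ = φ} uφ {A} part with Fin.any? (λ v → fresh? v φ ×-dec lookup A v Bool.≟ true)
... | yes found = found
... | no  none  = contradiction part (≤⇒≯ (begin
  ∣ A ∣                 ≡⟨ cong ∣_∣ (subset-ext A (A ∩ image φ ⊤) inside) ⟩
  ∣ A ∩ image φ ⊤ ∣     ≡⟨ ∣∩image∣ uφ A ⊤ ⟩
  ∣ trace φ A ∩ ⊤ ∣     ≡⟨ cong ∣_∣ (∩-identityʳ (trace φ A)) ⟩
  ∣ trace φ A ∣         ∎))
  where
  open ≤-Reasoning
  inside : ∀ v → lookup A v ≡ lookup (A ∩ image φ ⊤) v
  inside v rewrite lookup-zipWith _∧_ v A (image φ ⊤) with fresh? v φ
  ... | yes v∉φ rewrite image-fresh {φ = φ} ⊤ v∉φ with lookup A v in v∈A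
  ...   | false = refl
  ...   | true  = contradiction (v , v∉φ , v∈A) none
  inside v | no v∈φ with i , refl ← not-fresh φ v∈φ
    rewrite lookup-image uφ ⊤ i | lookup-replicate i true = sym (∧-identityʳ (lookup A (lookup φ i)))

-- Sending an entry of `xs` to its position in `ys` is injective: the position determines the entry,
-- and `xs` has no repetitions.
injection-length : ∀ {A : Set} {xs ys : List A} → Uniqueᴸ xs → (∀ {x} → x ∈ xs → x ∈ ys) →
                   length xs ≤ length ys
injection-length {A} {xs} {ys} u sub = Fin.injective⇒≤ {f = f} f-injective
  where
  f : Fin (length xs) → Fin (length ys)
  f i = Any.index (sub (∈-lookup {xs = xs} i))
  unique-lookup : ∀ {zs : List A} → Uniqueᴸ zs → ∀ i j → List.lookup zs i ≡ List.lookup zs j → i ≡ j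
  unique-lookup (_  ∷ u) zero    zero    eq = refl
  unique-lookup (x≢ ∷ u) zero    (suc j) eq = contradiction eq (All.lookup x≢ (∈-lookup j))
  unique-lookup (x≢ ∷ u) (suc i) zero    eq = contradiction (sym eq) (All.lookup x≢ (∈-lookup i))
  unique-lookup (_  ∷ u) (suc i) (suc j) eq = cong suc (unique-lookup u i j eq)
  f-injective : ∀ {i j} → f i ≡ f j → i ≡ j
  f-injective {i} {j} eq = unique-lookup u i j
    (trans (Any.lookup-index (sub (∈-lookup i)))
    (trans (cong (List.lookup ys) eq) (sym (Any.lookup-index (sub (∈-lookup j))))))

_≟ˢ_ : (A B : Subset n) → Dec (A ≡ B)
_≟ˢ_ = ≡-dec Bool._≟_

_∈?_ : (A : Subset n) (As : List (Subset n)) → Dec (A ∈ As)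
_∈?_ = Membership._∈?_ _≟ˢ_

all-subsets? : {P : Subset k → Set} → (∀ S → Dec (P S)) → Dec (∀ S → P S)
all-subsets? {zero}  P? = map′ (λ { p [] → p }) (λ p → p []) (P? [])
all-subsets? {suc k} P? = map′ (λ { (p , q) (false ∷ S) → p S ; (p , q) (true ∷ S) → q S })
                               (λ p → p ∘ (false ∷_) , p ∘ (true ∷_))
                               (all-subsets? (P? ∘ (false ∷_)) ×-dec all-subsets? (P? ∘ (true ∷_)))

unique-length : {φ : Vec (Fin n) k} → Unique φ → k ≤ n
unique-length {n} {k} {φ} uφ = begin
  k                 ≡⟨ sym (∣⊤∣≡n k) ⟩
  ∣ ⊤ {k} ∣         ≡⟨ sym (∣image∣ uφ ⊤) ⟩
  ∣ image φ ⊤ ∣     ≤⟨ ∣p∣≤n (image φ ⊤) ⟩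
  n                 ∎
  where open ≤-Reasoning

nonempty : (S : Subset k) → 0 < ∣ S ∣ → ∃[ i ] lookup S i ≡ true
nonempty (true  ∷ S) _ = zero , refl
nonempty (false ∷ S) p = let i , eq = nonempty S p in suc i , eq

-- Search trees over configurations and their decidable validity

-- A configuration lists the traces of some edges on k labelled vertices.
Config : ℕ → Set
Config k = List (Subset k)

data Mode : Set where
  twinFree : Mode
  order    : ℕ → Mode

data Query (k : ℕ) : Set where
  kill  : Subset k → Query k
  split : Fin k → Fin k → Query k
  fresh : Query k

-- use j ρ: the j-th of the later entries embeds, its label i going to the i-th hexadecimal digit of ρ.
data Ref : Set where
  leaf : Ref
  use  : ℕ → ℕ → Ref

-- A node of the search tree. The trace of the edge promised by the query is branched on, and each
-- branch has to be closed by one of the references.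
record Entry : Set where
  constructor entry
  field
    size   : ℕ
    config : Config size
    query  : Query size
    refs   : List Ref
open Entry

-- The most significant of the `j` digits comes first, so leading zeros in the tables are labels.
-- Reduction modulo `k` keeps the function total.
digits : ∀ j k .{{_ : NonZero k}} → ℕ → Vec (Fin k) j
digits zero    k m = []
digits (suc j) k m = ((m / 16 ^ j) {{m^n≢0 16 j}} % 16) mod k ∷ digits j k m

-- In mode `twinFree` such a configuration can join a core as a whole without raising the deficit;
-- in mode `order N` it witnesses the bound that is sought.
Terminal : Mode → Config k → Set
Terminal {k} twinFree C =
  0 < k × k ≤ length C × Uniqueᴸ C ×
  (∀ i → Any (λ T → lookup T i ≡ true) C) ×
  (∀ i j → i ≢ j → Any (λ T → lookup T i ≢ lookup T j) C)
Terminal (order N) C = N ≤ length C × Uniqueᴸ C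

terminal? : ∀ m (C : Config k) → Dec (Terminal m C)
terminal? {k} twinFree C =
  0 <? k ×-dec k ≤? length C ×-dec unique? _≟ˢ_ C ×-dec
  Fin.all? (λ i → Any.any? (λ T → lookup T i Bool.≟ true) C) ×-dec
  Fin.all? (λ i → Fin.all? λ j →
    ¬? (i Fin.≟ j) →-dec Any.any? (λ T → ¬? (lookup T i Bool.≟ lookup T j)) C)
terminal? (order N) C = N ≤? length C ×-dec unique? _≟ˢ_ C

-- Branches that would need more vertices than there are hold vacuously.
Room : Mode → ℕ → Set
Room twinFree  _ = Unit
Room (order N) k = k ≤ N

room? : ∀ m k → Dec (Room m k)
room? twinFree  k = yes tt
room? (order N) k = k ≤? N

-- The two alternatives of `kill` reflect saturation: a 4-set is an edge itself or is blocked by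
-- one. The query `fresh` promises a vertex instead of an edge.
Hits : Query k → Subset k → Set
Hits (kill S)    t = t ≡ S ⊎ ∣ t ∩ S ∣ ≡ 1
Hits (split i j) t = lookup t i ≢ lookup t j
Hits fresh       t = ⊥

hits? : (q : Query k) → ∀ t → Dec (Hits q t)
hits? (kill S)    t = t ≟ˢ S ⊎-dec ∣ t ∩ S ∣ ≟ 1
hits? (split i j) t = ¬? (lookup t i Bool.≟ lookup t j)
hits? fresh       t = no λ ()

Admissible : Config k → Query k → Subset k → Set
Admissible C q t = ∣ t ∣ ≤ 4 × Hits q t × All (λ T → ∣ t ∩ T ∣ ≢ 1) C

admissible? : (C : Config k) (q : Query k) → ∀ t → Dec (Admissible C q t)
admissible? C q t = ∣ t ∣ ≤? 4 ×-dec hits? q t ×-dec All.all? (λ T → ¬? (∣ t ∩ T ∣ ≟ 1)) C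

-- Since edges have four vertices, a restricted trace of size 4 means that the restriction to `ρ`
-- loses no vertex of the edge.
Embeds : ∀ {j} → Config k → Vec (Fin k) j → Config j → Set
Embeds C ρ C₀ = Unique ρ × All (λ T → ∣ T ∣ ≡ 4 × Any (λ T′ → map (lookup T′) ρ ≡ T) C) C₀

embeds? : ∀ {j} (C : Config k) (ρ : Vec (Fin k) j) (C₀ : Config j) → Dec (Embeds C ρ C₀)
embeds? C ρ C₀ = allPairs? (λ i j → ¬? (i Fin.≟ j)) ρ ×-dec
                 All.all? (λ T → ∣ T ∣ ≟ 4 ×-dec Any.any? (λ T′ → map (lookup T′) ρ ≟ˢ T) C) C₀

-- A separating edge is guaranteed only where there are no twins, and a further vertex only as long
-- as fewer than `N` are labelled.
Applies : Mode → Query k → Set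
Applies {k} _         (kill S)    = ∣ S ∣ ≡ 4
Applies     twinFree  (split i j) = i ≢ j
Applies     (order N) (split i j) = ⊥
Applies     twinFree  fresh       = ⊥
Applies {k} (order N) fresh       = k < N

applies? : ∀ m (q : Query k) → Dec (Applies m q)
applies?     _         (kill S)    = ∣ S ∣ ≟ 4
applies?     twinFree  (split i j) = ¬? (i Fin.≟ j)
applies?     (order N) (split i j) = no λ ()
applies?     twinFree  fresh       = no λ ()
applies? {k} (order N) fresh       = k <? N

module Check (m : Mode) (es : List Entry) where

  Closes : .{{_ : NonZero k}} → Config k → Ref → Set
  Closes {k} C leaf      = Terminal m C
  Closes {k} C (use j ρ) =
    Maybe.Any (λ e → Embeds C (digits (size e) k ρ) (config e)) (List.head (List.drop j es))

  closes? : .{{_ : NonZero k}} → (C : Config k) (r : Ref) → Dec (Closes C r)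
  closes? C leaf      = terminal? m C
  closes? C (use j ρ) = Maybe.dec (λ e → embeds? C _ (config e)) (List.head (List.drop j es))

  -- The j vertices of the new edge outside the configuration are prepended one by one.
  Grows : ℕ → .{{_ : NonZero k}} → Config k → Subset k → List Ref → Set
  Grows zero    C t rs = Any (Closes (t ∷ C)) rs
  Grows {k} (suc j) C t rs = Room m (suc k) → Grows j (List.map (false ∷_) C) (true ∷ t) rs

  grows? : ∀ j .{{_ : NonZero k}} (C : Config k) t rs → Dec (Grows j C t rs)
  grows? zero    C t rs = Any.any? (closes? (t ∷ C)) rs
  grows? {k} (suc j) C t rs = room? m (suc k) →-dec grows? j (List.map (false ∷_) C) (true ∷ t) rs

  Branches : .{{_ : NonZero k}} → Config k → Query k → List Ref → Set
  Branches C fresh rs = Any (Closes (List.map (false ∷_) C)) rs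
  Branches C q     rs = ∀ t → Admissible C q t → Grows (4 ∸ ∣ t ∣) C t rs

  branches? : .{{_ : NonZero k}} → ∀ (C : Config k) q rs → Dec (Branches C q rs)
  branches? C fresh           rs = Any.any? (closes? (List.map (false ∷_) C)) rs
  branches? C q@(kill _)      rs = all-subsets? λ t → admissible? C q t →-dec grows? (4 ∸ ∣ t ∣) C t rs
  branches? C q@(split _ _)   rs = all-subsets? λ t → admissible? C q t →-dec grows? (4 ∸ ∣ t ∣) C t rs

  Step : Entry → Set
  Step (entry zero    C q rs) = ⊥
  Step (entry (suc k) C q rs) = Applies m q × Branches C q rs

  step? : ∀ e → Dec (Step e)
  step? (entry zero    C q rs) = no λ ()
  step? (entry (suc k) C q rs) = applies? m q ×-dec branches? C q rs

-- An entry is checked against the entries after it only, so references cannot be circular and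
-- soundness follows by induction from the end of the table.
data Valid (m : Mode) : List Entry → Set where
  []  : Valid m []
  _∷_ : ∀ {e es} → Check.Step m es e → Valid m es → Valid m (e ∷ es)

valid? : ∀ m es → Dec (Valid m es)
valid? m []       = yes []
valid? m (e ∷ es) = map′ (λ (s , v) → s ∷ v) (λ { (s ∷ v) → s , v }) (Check.step? m es e ×-dec valid? m es)

-- Soundness of the search in a saturated hypergraph

module Saturated {n} (G : Hypergraph4 n) (sat : B4Saturated G) where

  E : List (Subset n)
  E = edges G

  ∣edge∣ : ∀ {A} → A ∈ E → ∣ A ∣ ≡ 4
  ∣edge∣ = All.lookup (uniform G)

  -- Either the labelled 4-set is an edge, whose trace is `S`, or saturation supplies an edge that
  -- blocks it, and `∣∩image∣` carries the count over to traces.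
  killed : {φ : Vec (Fin n) k} → Unique φ → ∀ S → ∣ S ∣ ≡ 4 →
           ∃[ A ] A ∈ E × (trace φ A ≡ S ⊎ ∣ trace φ A ∩ S ∣ ≡ 1)
  killed {φ = φ} uφ S ∣S∣ with image φ S ∈? E
  ... | yes S∈E = image φ S , S∈E , inj₁ (trace-image uφ S)
  ... | no  S∉E with A , A∈E , hit ← find (proj₂ sat (image φ S) (trans (∣image∣ uφ S) ∣S∣) S∉E)
    = A , A∈E , inj₂ (trans (sym (∣∩image∣ uφ A S)) hit)

  -- An edge with a trace of size 4 is the image of that trace, so its intersections with other
  -- edges are fully visible on the labels.
  bowtie-free : {φ : Vec (Fin n) k} → Unique φ → ∀ {A D} → A ∈ E → D ∈ E →
                ∣ trace φ A ∣ ≡ 4 → ∣ trace φ D ∩ trace φ A ∣ ≢ 1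
  bowtie-free {φ = φ} uφ {A} {D} A∈E D∈E full hit = proj₁ sat D A D∈E A∈E (begin
    ∣ D ∩ A ∣                       ≡⟨ cong (λ B → ∣ D ∩ B ∣) (sym (image-trace uφ {A} (trans full (sym (∣edge∣ A∈E))))) ⟩
    ∣ D ∩ image φ (trace φ A) ∣     ≡⟨ ∣∩image∣ uφ D (trace φ A) ⟩
    ∣ trace φ D ∩ trace φ A ∣       ≡⟨ hit ⟩
    1                               ∎)
    where open ≡-Reasoning

  -- Size 4 places the whole edge among the labelled vertices, which `bowtie-free` requires.
  Realised : Vec (Fin n) k → Config k → Set
  Realised φ C = Unique φ × All (λ T → ∣ T ∣ ≡ 4 × ∃[ A ] A ∈ E × trace φ A ≡ T) C

  fresh-realised : ∀ {v} {φ : Vec (Fin n) k} {C} → Fresh v φ → Realised φ C →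
                   Realised (v ∷ φ) (List.map (false ∷_) C)
  fresh-realised v∉φ (uφ , real) =
    (v∉φ ∷ uφ) , All.map⁺ (All.map
      (λ { (full , A , A∈E , refl) → full , A , A∈E ,
           cong (_∷ _) (trace-full-fresh uφ {A} (trans full (sym (∣edge∣ A∈E))) v∉φ) }) real)

  embedded : ∀ {j} {φ : Vec (Fin n) k} {C} {ρ : Vec (Fin k) j} {C₀} →
             Embeds C ρ C₀ → Realised φ C → Realised (map (lookup φ) ρ) C₀
  embedded {φ = φ} {C} {ρ} (uρ , emb) (uφ , real) =
    Unique.map⁺ (Unique.lookup-injective uφ _ _) uρ , All.map (λ { (∣T∣ , T′∈) → ∣T∣ , pull T′∈ }) emb
    where
    pull : ∀ {T} → Any (λ T′ → map (lookup T′) ρ ≡ T) C → ∃[ A ] A ∈ E × trace (map (lookup φ) ρ) A ≡ T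
    pull T′∈ with T′ , T′∈C , refl ← find T′∈
      with _ , A , A∈E , refl ← All.lookup real T′∈C
      = A , A∈E , trans (sym (map-∘ (lookup A) (lookup φ) ρ)) (map-cong (λ i → sym (lookup-map i (lookup A) φ)) ρ)

  small-trace : ∀ {φ : Vec (Fin n) k} {D} → Unique φ → D ∈ E → ∣ trace φ D ∣ ≤ 4
  small-trace {D = D} uφ D∈E = ≤-trans (∣trace∣≤ uφ D) (≤-reflexive (∣edge∣ D∈E))

  legal-trace : ∀ {φ : Vec (Fin n) k} {C D} → Realised φ C → D ∈ E → All (λ T → ∣ trace φ D ∩ T ∣ ≢ 1) C
  legal-trace (uφ , real) D∈E =
    All.map (λ { (full , A , A∈E , refl) → bowtie-free uφ A∈E D∈E full }) real

  next-vertex : ∀ {φ : Vec (Fin n) k} {D j} → Unique φ → D ∈ E → ∣ trace φ D ∣ + suc j ≡ 4 →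
                ∃[ v ] Fresh v φ × lookup D v ≡ true
  next-vertex {D = D} uφ D∈E size =
    fresh-element uφ {D} (≤-trans (m<m+n _ (s≤s z≤n)) (≤-reflexive (trans size (sym (∣edge∣ D∈E)))))

  -- `Q` confines the search to a union of components: the covered vertices beyond a closed core, or
  -- all vertices when the order is fixed.
  module Search (Q : Fin n → Set)
    (Q-closed : ∀ {A u v} → A ∈ E → lookup A u ≡ true → lookup A v ≡ true → Q u → Q v) where

    Hypothesis : Mode → Set
    Hypothesis twinFree  = ∀ u v → Q u → Q v → u ≢ v → ∃[ A ] A ∈ E × lookup A u ≢ lookup A v
    Hypothesis (order N) = n ≡ N × (∀ v → Q v)

    Goal : Mode → Set
    Goal m = ∃[ k ] ∃[ φ ] ∃[ C ] Allⱽ Q φ × Realised {k} φ C × Terminal m C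

    earlier : ∀ {P R : Entry → Set} {es} → All P es → ∀ j →
              Maybe.Any R (List.head (List.drop j es)) → ∃[ e ] P e × R e
    earlier (p ∷ ps) zero    (Maybe.just r) = _ , p , r
    earlier (p ∷ ps) (suc j) r              = earlier ps j r

    -- A labelled vertex on the promised edge is what passes `Q` on to the new vertices of that
    -- edge.
    hit-vertex : ∀ (q : Query k) {t} → (∀ S → q ≡ kill S → ∣ S ∣ ≡ 4) → Hits q t → ∃[ i ] lookup t i ≡ true
    hit-vertex (kill S)    ∣S∣ (inj₁ refl) = nonempty S (subst (0 <_) (sym (∣S∣ S refl)) (s≤s z≤n))
    hit-vertex (kill S) {t} ∣S∣ (inj₂ hit) =
      nonempty t (≤-trans (≤-reflexive (sym hit)) (∣p∩q∣≤∣p∣ t S))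
    hit-vertex (split i j) {t} _ sep with lookup t i in tᵢ | lookup t j in tⱼ
    ... | true  | _     = i , tᵢ
    ... | false | true  = j , tⱼ
    ... | false | false = contradiction refl sep

    separator : ∀ m → Hypothesis m → ∀ {φ : Vec (Fin n) k} {C} i j → Applies m (split i j) → Allⱽ Q φ → Realised φ C →
                ∃[ D ] D ∈ E × Hits (split i j) (trace φ D)
    separator twinFree hyp {φ} i j i≢j Qφ (uφ , _)
      with D , D∈E , sep ← hyp _ _ (Allⱽ.lookup⁺ Qφ i) (Allⱽ.lookup⁺ Qφ j) (i≢j ∘ Unique.lookup-injective uφ i j)
      = D , D∈E , λ eq → sep (trans (sym (lookup-map i (lookup D) φ)) (trans eq (lookup-map j (lookup D) φ)))

    unused : ∀ m → Hypothesis m → ∀ {φ : Vec (Fin n) k} {C} → Applies {k} m fresh → Realised φ C →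
             ∃[ v ] Fresh v φ × Q v
    unused {k} (order _) (refl , all) {φ} k<n (uφ , _)
      with v , v∉φ , _ ← fresh-element uφ {⊤} (≤-trans (s≤s (∣p∣≤n (trace φ ⊤))) (≤-trans k<n (≤-reflexive (sym (∣⊤∣≡n n)))))
      = v , v∉φ , all v

    room : ∀ m → Hypothesis m → {φ : Vec (Fin n) k} → Unique φ → Room m k
    room twinFree  _           uφ = tt
    room (order N) (refl , _) uφ = unique-length uφ

    module _ (m : Mode) (hyp : Hypothesis m) where

      Sound : Entry → Set
      Sound e = ∀ {φ} → Allⱽ Q φ → Realised φ (config e) → Goal m

      module _ {es : List Entry} (sound : All Sound es) where
        open Check m es

        closes-sound : .{{_ : NonZero k}} → ∀ {φ : Vec (Fin n) k} {C} r →
                       Closes C r → Allⱽ Q φ → Realised φ C → Goal m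
        closes-sound leaf      rep Qφ real = _ , _ , _ , Qφ , real , rep
        closes-sound (use j ρ) emb Qφ real with e , se , emb′ ← earlier sound j emb =
          se (Allⱽ.map⁺ (Allⱽ.universal (λ i → Allⱽ.lookup⁺ Qφ i) _)) (embedded emb′ real)

        -- Induction on the number of vertices of `D` that are not labelled yet. Label `i` lies on
        -- `D`, so each of them inherits `Q` from it.
        grows-sound : ∀ j .{{_ : NonZero k}} {φ : Vec (Fin n) k} {C t rs D i} → D ∈ E → trace φ D ≡ t →
                      lookup t i ≡ true → ∣ t ∣ + j ≡ 4 → Grows j C t rs → Allⱽ Q φ → Realised φ C → Goal m
        grows-sound zero {t = t} {D = D} D∈E eq _ size grow Qφ (uφ , real) with r , _ , c ← find grow =
          closes-sound r c Qφ (uφ , (trans (sym (+-identityʳ _)) size , D , D∈E , eq) ∷ real)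
        grows-sound (suc j) {φ = φ} {D = D} {i} D∈E refl tᵢ size grow Qφ real@(uφ , _)
          with v , v∉φ , v∈D ← next-vertex uφ D∈E size
          = grows-sound j {i = suc i} D∈E (cong (_∷ trace φ D) v∈D) tᵢ (trans (sym (+-suc _ j)) size)
              (grow (room m hyp (v∉φ ∷ uφ))) (Qv ∷ Qφ) (fresh-realised v∉φ real)
          where
          Qv : Q v
          Qv = Q-closed D∈E (trans (sym (lookup-map i (lookup D) φ)) tᵢ) v∈D (Allⱽ.lookup⁺ Qφ i)

        branch-sound : .{{_ : NonZero k}} → ∀ {φ : Vec (Fin n) k} {C} (q : Query k) {rs D} →
                       (∀ S → q ≡ kill S → ∣ S ∣ ≡ 4) → D ∈ E → Hits q (trace φ D) →
                       (∀ t → Admissible C q t → Grows (4 ∸ ∣ t ∣) C t rs) → Allⱽ Q φ → Realised φ C → Goal m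
        branch-sound {φ = φ} {C} q {D = D} ∣S∣ D∈E hit branches Qφ real@(uφ , _) with i , tᵢ ← hit-vertex q ∣S∣ hit =
          grows-sound (4 ∸ ∣ trace φ D ∣) D∈E refl tᵢ (m+[n∸m]≡n small)
            (branches _ (small , hit , legal-trace real D∈E)) Qφ real
          where
          small : ∣ trace φ D ∣ ≤ 4
          small = small-trace uφ D∈E

        step-sound : ∀ e → Step e → Sound e
        step-sound (entry (suc k) C (kill S) rs) (∣S∣ , branches) Qφ real@(uφ , _)
          with D , D∈E , hit ← killed uφ S ∣S∣
          = branch-sound (kill S) (λ { _ refl → ∣S∣ }) D∈E hit branches Qφ real
        step-sound (entry (suc k) C (split i j) rs) (ok , branches) Qφ real
          with D , D∈E , hit ← separator m hyp i j ok Qφ real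
          = branch-sound (split i j) (λ _ ()) D∈E hit branches Qφ real
        step-sound (entry (suc k) C fresh rs) (ok , branches) Qφ real
          with v , v∉φ , Qv ← unused m hyp ok real | r , _ , c ← find branches
          = closes-sound r c (Qv ∷ Qφ) (fresh-realised v∉φ real)

      valid-sound : ∀ {es} → Valid m es → All Sound es
      valid-sound []      = []
      valid-sound (s ∷ v) = step-sound (valid-sound v) _ s ∷ valid-sound v

-- The search tables

points : ∀ {k} .{{_ : NonZero k}} → ℕ → ℕ → Subset k
points j m = image (digits j _ m) ⊤

edge : ∀ {k} .{{_ : NonZero k}} → ℕ → Subset k
edge = points 4

-- The three tables were found by a computer search that skips configurations containing an earlier one.

twin-free-search : List Entry
twin-free-search =
  entry 4 (List.map edge (0x0123 ∷ [])) (split (# 0) (# 1))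
    (use 5 0x01234 ∷ use 5 0x02134 ∷ use 0 0x012345 ∷ use 0 0x012354 ∷ use 0 0x013245 ∷ use 0 0x013254 ∷ []) ∷
  entry 6 (List.map edge (0x2345 ∷ 0x0124 ∷ [])) (kill (edge 0x0135))
    (use 0 0x012345 ∷ use 5 0x4603215 ∷ use 5 0x4603125 ∷ use 5 0x1203645 ∷ use 5 0x1203465 ∷ []) ∷
  entry 6 (List.map edge (0x2345 ∷ 0x0124 ∷ 0x0135 ∷ [])) (split (# 0) (# 1))
    (use 3 0x02534 ∷ use 3 0x02435 ∷ use 3 0x02345 ∷ use 3 0x03245 ∷ use 3 0x12534 ∷ use 3 0x12435 ∷
     use 3 0x12345 ∷ use 3 0x13245 ∷ use 0 0x0123456 ∷ use 0 0x0123654 ∷ use 0 0x0124563 ∷ use 0 0x0125634 ∷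
     use 0 0x0213456 ∷ use 0 0x0213654 ∷ use 0 0x0214563 ∷ use 0 0x0215634 ∷ []) ∷
  entry 7 (List.map edge (0x3456 ∷ 0x1235 ∷ 0x1246 ∷ 0x0134 ∷ [])) (kill (edge 0x0156))
    (use 0 0x0123456 ∷ use 3 0x5623104 ∷ use 3 0x5623014 ∷ use 3 0x0123654 ∷ use 3 0x0123564 ∷
     use 4 0x63702145 ∷ []) ∷
  entry 7 (List.map edge (0x3456 ∷ 0x1235 ∷ 0x1246 ∷ 0x0134 ∷ 0x0156 ∷ [])) (kill (edge 0x0236))
    (use 0 0x0123456 ∷ use 2 0x2651304 ∷ use 2 0x0641325 ∷ use 2 0x0641235 ∷ use 2 0x0351264 ∷ []) ∷
  entry 7 (List.map edge (0x3456 ∷ 0x1235 ∷ 0x1246 ∷ 0x0134 ∷ 0x0156 ∷ 0x0236 ∷ [])) (kill (edge 0x0245))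
    (leaf ∷ []) ∷
  entry 5 (List.map edge (0x1234 ∷ 0x0134 ∷ [])) (kill (edge 0x0123))
    (use 20 0x01234 ∷ use 0 0x0123456 ∷ use 0 0x0125436 ∷ []) ∷
  entry 7 (List.map edge (0x3456 ∷ 0x2356 ∷ 0x0136 ∷ [])) (kill (edge 0x2346))
    (use 19 0x23465 ∷ use 16 0x0123456 ∷ use 16 0x0126435 ∷ use 0 0x01234567 ∷ use 0 0x21037546 ∷
     use 0 0x02134567 ∷ use 0 0x12037546 ∷ []) ∷
  entry 8 (List.map edge (0x4567 ∷ 0x3467 ∷ 0x1247 ∷ 0x0146 ∷ [])) (kill (edge 0x1467))
    (use 12 0x01234567 ∷ use 4 0x01234567 ∷ use 4 0x21034576 ∷ use 0 0x012345678 ∷ []) ∷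
  entry 9 (List.map edge (0x5678 ∷ 0x4578 ∷ 0x2358 ∷ 0x1257 ∷ 0x0123 ∷ [])) (kill (edge 0x1258))
    (use 14 0x1245678 ∷ use 0 0x012345678 ∷ []) ∷
  entry 9 (List.map edge (0x5678 ∷ 0x4578 ∷ 0x2358 ∷ 0x1257 ∷ 0x0123 ∷ 0x0357 ∷ [])) (kill (edge 0x2357))
    (use 13 0x2345678 ∷ use 0 0x012345678 ∷ []) ∷
  entry 9 (List.map edge (0x5678 ∷ 0x4578 ∷ 0x2358 ∷ 0x1257 ∷ 0x0123 ∷ 0x0357 ∷ 0x0158 ∷ [])) (kill (edge 0x0257))
    (use 5 0x38615027 ∷ use 5 0x07625138 ∷ use 0 0x012345678 ∷ []) ∷
  entry 9 (List.map edge (0x5678 ∷ 0x4578 ∷ 0x2358 ∷ 0x1257 ∷ 0x0123 ∷ 0x0357 ∷ 0x0158 ∷ 0x1378 ∷ [])) (kill (edge 0x1357))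
    (leaf ∷ []) ∷
  entry 8 (List.map edge (0x4567 ∷ 0x3467 ∷ 0x1247 ∷ 0x0146 ∷ 0x0356 ∷ [])) (kill (edge 0x0467))
    (use 5 0x01234567 ∷ use 1 0x01234567 ∷ use 0 0x01234567 ∷ []) ∷
  entry 8 (List.map edge (0x4567 ∷ 0x3467 ∷ 0x1247 ∷ 0x0146 ∷ 0x0356 ∷ 0x2357 ∷ [])) (kill (edge 0x0267))
    (use 0 0x20136574 ∷ []) ∷
  entry 8 (List.map edge (0x4567 ∷ 0x3467 ∷ 0x1247 ∷ 0x0146 ∷ 0x0356 ∷ 0x1345 ∷ [])) (kill (edge 0x1367))
    (use 2 0x01234567 ∷ use 1 0x01234567 ∷ use 0 0x01234567 ∷ []) ∷
  entry 8 (List.map edge (0x4567 ∷ 0x3467 ∷ 0x1247 ∷ 0x0146 ∷ 0x0356 ∷ 0x1345 ∷ 0x2456 ∷ [])) (kill (edge 0x1567))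
    (leaf ∷ []) ∷
  entry 8 (List.map edge (0x4567 ∷ 0x3467 ∷ 0x1247 ∷ 0x0146 ∷ 0x0356 ∷ 0x1345 ∷ 0x0457 ∷ [])) (kill (edge 0x1567))
    (leaf ∷ []) ∷
  entry 8 (List.map edge (0x4567 ∷ 0x3467 ∷ 0x1247 ∷ 0x0146 ∷ 0x0356 ∷ 0x1345 ∷ 0x1367 ∷ [])) (kill (edge 0x0347))
    (leaf ∷ []) ∷
  entry 8 (List.map edge (0x4567 ∷ 0x3467 ∷ 0x1247 ∷ 0x0146 ∷ 0x0356 ∷ 0x0467 ∷ [])) (kill (edge 0x0167))
    (use 9 0x3576401 ∷ use 0 0x01234567 ∷ use 0 0x01254367 ∷ []) ∷
  entry 8 (List.map edge (0x4567 ∷ 0x3467 ∷ 0x1247 ∷ 0x0146 ∷ 0x0356 ∷ 0x0467 ∷ 0x2346 ∷ [])) (kill (edge 0x0246))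
    (leaf ∷ []) ∷
  entry 8 (List.map edge (0x4567 ∷ 0x3467 ∷ 0x1247 ∷ 0x0146 ∷ 0x1467 ∷ [])) (kill (edge 0x0467))
    (use 6 0x274160 ∷ use 0 0x01234567 ∷ []) ∷
  entry 8 (List.map edge (0x4567 ∷ 0x3467 ∷ 0x1247 ∷ 0x0146 ∷ 0x1467 ∷ 0x1345 ∷ [])) (kill (edge 0x0147))
    (use 6 0x3574610 ∷ use 0 0x01234567 ∷ use 0 0x01254367 ∷ []) ∷
  entry 8 (List.map edge (0x4567 ∷ 0x3467 ∷ 0x1247 ∷ 0x0146 ∷ 0x1467 ∷ 0x1345 ∷ 0x2346 ∷ [])) (kill (edge 0x1246))
    (leaf ∷ []) ∷
  entry 7 (List.map edge (0x3456 ∷ 0x2356 ∷ 0x0136 ∷ 0x0135 ∷ [])) (kill (edge 0x0156))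
    (use 2 0x50316 ∷ use 0 0x0123456 ∷ use 0 0x1023456 ∷ []) ∷
  entry 7 (List.map edge (0x3456 ∷ 0x2356 ∷ 0x0136 ∷ 0x0135 ∷ 0x0234 ∷ [])) (kill (edge 0x0356))
    (use 3 0x2453601 ∷ use 0 0x0123456 ∷ []) ∷
  entry 7 (List.map edge (0x3456 ∷ 0x2356 ∷ 0x0136 ∷ 0x0135 ∷ 0x0234 ∷ 0x1234 ∷ [])) (kill (edge 0x0235))
    (leaf ∷ []) ∷
  entry 5 (List.map edge (0x1234 ∷ 0x0134 ∷ 0x0123 ∷ [])) (split (# 1) (# 3))
    (use 5 0x01234 ∷ use 5 0x03124 ∷ use 0 0x012345 ∷ use 0 0x012543 ∷ use 0 0x014325 ∷ use 0 0x014523 ∷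
     use 0 0x032541 ∷ use 0 0x034521 ∷ []) ∷
  entry 6 (List.map edge (0x2345 ∷ 0x1245 ∷ 0x1234 ∷ 0x0123 ∷ [])) (kill (edge 0x1235))
    (use 4 0x12345 ∷ use 0 0x0123456 ∷ []) ∷
  entry 7 (List.map edge (0x3456 ∷ 0x2356 ∷ 0x2345 ∷ 0x1234 ∷ 0x0135 ∷ [])) (kill (edge 0x1245))
    (use 1 0x0123456 ∷ use 0 0x0123456 ∷ use 0 0x0143256 ∷ []) ∷
  entry 7 (List.map edge (0x3456 ∷ 0x2356 ∷ 0x2345 ∷ 0x1234 ∷ 0x0135 ∷ 0x0236 ∷ [])) (kill (edge 0x0234))
    (leaf ∷ []) ∷
  entry 7 (List.map edge (0x3456 ∷ 0x2356 ∷ 0x2345 ∷ 0x1234 ∷ 0x0135 ∷ 0x1245 ∷ [])) (kill (edge 0x1235))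
    (leaf ∷ use 0 0x01234567 ∷ []) ∷
  entry 8 (List.map edge (0x4567 ∷ 0x3467 ∷ 0x3456 ∷ 0x2345 ∷ 0x1246 ∷ 0x2356 ∷ 0x0357 ∷ [])) (kill (edge 0x2347))
    (leaf ∷ []) ∷
  entry 5 (List.map edge (0x1234 ∷ 0x0134 ∷ 0x0123 ∷ 0x0124 ∷ [])) (kill (edge 0x0234))
    (leaf ∷ []) ∷
  []

order-7-search : List Entry
order-7-search =
  entry 4 (List.map edge (0x0123 ∷ [])) fresh
    (use 0 0x01234 ∷ []) ∷
  entry 5 (List.map edge (0x1234 ∷ [])) (kill (edge 0x0123))
    (use 5 0x01234 ∷ use 0 0x0123456 ∷ use 0 0x0124356 ∷ use 0 0x0125346 ∷ []) ∷
  entry 7 (List.map edge (0x3456 ∷ 0x0136 ∷ [])) (kill (edge 0x0346))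
    (use 4 0x03465 ∷ use 0 0x0123456 ∷ use 0 0x2106435 ∷ []) ∷
  entry 7 (List.map edge (0x3456 ∷ 0x0136 ∷ 0x1235 ∷ [])) (kill (edge 0x1356))
    (use 3 0x13564 ∷ use 0 0x0123456 ∷ []) ∷
  entry 7 (List.map edge (0x3456 ∷ 0x0136 ∷ 0x1235 ∷ 0x0234 ∷ [])) (kill (edge 0x0134))
    (use 3 0x2541036 ∷ use 0 0x0123456 ∷ use 3 0x0123564 ∷ []) ∷
  entry 7 (List.map edge (0x3456 ∷ 0x0136 ∷ 0x1235 ∷ 0x0234 ∷ 0x0256 ∷ [])) (kill (edge 0x0235))
    (use 2 0x4603251 ∷ use 0 0x0123456 ∷ []) ∷
  entry 7 (List.map edge (0x3456 ∷ 0x0136 ∷ 0x1235 ∷ 0x0234 ∷ 0x0256 ∷ 0x1246 ∷ [])) (kill (edge 0x0236))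
    (leaf ∷ []) ∷
  entry 5 (List.map edge (0x1234 ∷ 0x0123 ∷ [])) (kill (edge 0x0124))
    (use 4 0x01234 ∷ use 0 0x0123456 ∷ use 0 0x0124356 ∷ []) ∷
  entry 7 (List.map edge (0x3456 ∷ 0x2345 ∷ 0x0135 ∷ [])) (kill (edge 0x2356))
    (use 4 0x0123546 ∷ use 0 0x0123456 ∷ use 0 0x0125346 ∷ []) ∷
  entry 7 (List.map edge (0x3456 ∷ 0x2345 ∷ 0x0135 ∷ 0x0134 ∷ [])) (kill (edge 0x0345))
    (use 2 0x40315 ∷ use 0 0x0123456 ∷ []) ∷
  entry 7 (List.map edge (0x3456 ∷ 0x2345 ∷ 0x0135 ∷ 0x0134 ∷ 0x1236 ∷ [])) (kill (edge 0x1345))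
    (use 3 0x2603145 ∷ use 0 0x0123456 ∷ []) ∷
  entry 7 (List.map edge (0x3456 ∷ 0x2345 ∷ 0x0135 ∷ 0x0134 ∷ 0x1236 ∷ 0x0236 ∷ [])) (kill (edge 0x0234))
    (leaf ∷ []) ∷
  entry 5 (List.map edge (0x1234 ∷ 0x0123 ∷ 0x0124 ∷ [])) (kill (edge 0x0134))
    (use 6 0x01234 ∷ use 0 0x0123456 ∷ []) ∷
  entry 7 (List.map edge (0x3456 ∷ 0x2345 ∷ 0x2346 ∷ 0x0134 ∷ [])) (kill (edge 0x0234))
    (use 2 0x0123456 ∷ use 0 0x0123456 ∷ use 0 0x0124356 ∷ []) ∷
  entry 7 (List.map edge (0x3456 ∷ 0x2345 ∷ 0x2346 ∷ 0x0134 ∷ 0x1356 ∷ [])) (kill (edge 0x1345))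
    (use 1 0x1053426 ∷ use 0 0x0123456 ∷ []) ∷
  entry 7 (List.map edge (0x3456 ∷ 0x2345 ∷ 0x2346 ∷ 0x0134 ∷ 0x1356 ∷ 0x0236 ∷ [])) (kill (edge 0x0346))
    (leaf ∷ []) ∷
  entry 7 (List.map edge (0x3456 ∷ 0x2345 ∷ 0x2346 ∷ 0x0134 ∷ 0x0234 ∷ [])) (kill (edge 0x0345))
    (use 1 0x0123456 ∷ use 0 0x0123456 ∷ use 0 0x0124356 ∷ []) ∷
  entry 7 (List.map edge (0x3456 ∷ 0x2345 ∷ 0x2346 ∷ 0x0134 ∷ 0x0234 ∷ 0x1236 ∷ [])) (kill (edge 0x1234))
    (leaf ∷ []) ∷
  entry 7 (List.map edge (0x3456 ∷ 0x2345 ∷ 0x2346 ∷ 0x0134 ∷ 0x0234 ∷ 0x0345 ∷ [])) (kill (edge 0x0235))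
    (leaf ∷ []) ∷
  entry 5 (List.map edge (0x1234 ∷ 0x0123 ∷ 0x0124 ∷ 0x0134 ∷ [])) (kill (edge 0x0234))
    (use 0 0x01234 ∷ []) ∷
  entry 5 (List.map edge (0x1234 ∷ 0x0123 ∷ 0x0124 ∷ 0x0134 ∷ 0x0234 ∷ [])) fresh
    (use 0 0x012345 ∷ []) ∷
  entry 6 (List.map edge (0x2345 ∷ 0x1234 ∷ 0x1235 ∷ 0x1245 ∷ 0x1345 ∷ [])) (kill (edge 0x0123))
    (use 0 0x012345 ∷ use 0 0x025634 ∷ use 0 0x063524 ∷ use 0 0x064523 ∷ []) ∷
  entry 6 (List.map edge (0x2345 ∷ 0x1234 ∷ 0x1235 ∷ 0x1245 ∷ 0x1345 ∷ 0x0123 ∷ [])) (kill (edge 0x0124))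
    (leaf ∷ []) ∷
  []

order-8-search : List Entry
order-8-search =
  entry 4 (List.map edge (0x0123 ∷ [])) fresh
    (use 0 0x01234 ∷ []) ∷
  entry 5 (List.map edge (0x1234 ∷ [])) (kill (edge 0x0123))
    (use 8 0x01234 ∷ use 1 0x0123456 ∷ use 1 0x0124356 ∷ use 1 0x0125346 ∷ use 0 0x01234567 ∷ []) ∷
  entry 8 (List.map edge (0x4567 ∷ 0x0123 ∷ [])) (kill (edge 0x0145))
    (use 0 0x0124675 ∷ use 0 0x0216457 ∷ use 0 0x0316457 ∷ use 0 0x1206457 ∷ use 0 0x1306457 ∷
     use 0 0x2304576 ∷ use 0 0x2304567 ∷ use 0 0x2305476 ∷ use 0 0x2305467 ∷ []) ∷
  entry 7 (List.map edge (0x3456 ∷ 0x0136 ∷ [])) (kill (edge 0x0145))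
    (use 0 0x0123456 ∷ use 7 0x4523061 ∷ use 7 0x4523160 ∷ use 7 0x0123465 ∷ use 7 0x0123564 ∷
     use 7 0x5604172 ∷ use 7 0x5604271 ∷ use 7 0x1204576 ∷ use 7 0x1204675 ∷ []) ∷
  entry 7 (List.map edge (0x3456 ∷ 0x0136 ∷ 0x0145 ∷ [])) (kill (edge 0x0234))
    (use 0 0x0123456 ∷ use 5 0x50163 ∷ use 0 0x1025634 ∷ use 5 0x13564 ∷ use 5 0x14563 ∷ use 0 0x1206745 ∷
     use 0 0x2104657 ∷ use 0 0x2105746 ∷ []) ∷
  entry 7 (List.map edge (0x3456 ∷ 0x0136 ∷ 0x0145 ∷ 0x0234 ∷ [])) (kill (edge 0x0256))
    (use 0 0x0123456 ∷ use 5 0x5613042 ∷ use 5 0x5613240 ∷ use 5 0x0213546 ∷ use 5 0x0213645 ∷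
     use 6 0x72601453 ∷ []) ∷
  entry 7 (List.map edge (0x3456 ∷ 0x0136 ∷ 0x0145 ∷ 0x0234 ∷ 0x0256 ∷ [])) (kill (edge 0x1235))
    (use 0 0x0123456 ∷ use 4 0x2540163 ∷ use 4 0x1560243 ∷ use 4 0x2540361 ∷ use 4 0x2360541 ∷ []) ∷
  entry 7 (List.map edge (0x3456 ∷ 0x0136 ∷ 0x0145 ∷ 0x0234 ∷ 0x0256 ∷ 0x1235 ∷ [])) (kill (edge 0x1246))
    (use 0 0x0123456 ∷ use 3 0x2450136 ∷ use 3 0x1650234 ∷ use 3 0x1203456 ∷ use 3 0x1203654 ∷ []) ∷
  entry 7 (List.map edge (0x3456 ∷ 0x0136 ∷ 0x0145 ∷ 0x0234 ∷ 0x0256 ∷ 0x1235 ∷ 0x1246 ∷ [])) fresh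
    (use 0 0x01234567 ∷ []) ∷
  entry 8 (List.map edge (0x4567 ∷ 0x1247 ∷ 0x1256 ∷ 0x1345 ∷ 0x1367 ∷ 0x2346 ∷ 0x2357 ∷ [])) (kill (edge 0x0123))
    (leaf ∷ []) ∷
  entry 5 (List.map edge (0x1234 ∷ 0x0123 ∷ [])) (kill (edge 0x0124))
    (use 14 0x01234 ∷ use 0 0x0123456 ∷ use 0 0x0124356 ∷ []) ∷
  entry 7 (List.map edge (0x3456 ∷ 0x2345 ∷ 0x0135 ∷ [])) (kill (edge 0x2356))
    (use 14 0x0123546 ∷ use 9 0x0123456 ∷ use 9 0x0125346 ∷ use 0 0x01234567 ∷ use 0 0x21036457 ∷
     use 0 0x02134567 ∷ use 0 0x12036457 ∷ []) ∷
  entry 8 (List.map edge (0x4567 ∷ 0x3456 ∷ 0x1246 ∷ 0x0145 ∷ [])) (kill (edge 0x1456))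
    (use 5 0x01234567 ∷ use 0 0x01234567 ∷ use 0 0x21034657 ∷ []) ∷
  entry 8 (List.map edge (0x4567 ∷ 0x3456 ∷ 0x1246 ∷ 0x0145 ∷ 0x0357 ∷ [])) (kill (edge 0x0256))
    (use 2 0x01234567 ∷ use 0 0x01234567 ∷ use 0 0x01274563 ∷ []) ∷
  entry 8 (List.map edge (0x4567 ∷ 0x3456 ∷ 0x1246 ∷ 0x0145 ∷ 0x0357 ∷ 0x1345 ∷ [])) (kill (edge 0x1356))
    (use 16 0x0715346 ∷ use 0 0x01234567 ∷ use 0 0x76234510 ∷ []) ∷
  entry 8 (List.map edge (0x4567 ∷ 0x3456 ∷ 0x1246 ∷ 0x0145 ∷ 0x0357 ∷ 0x1345 ∷ 0x0245 ∷ [])) (kill (edge 0x0456))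
    (leaf ∷ []) ∷
  entry 8 (List.map edge (0x4567 ∷ 0x3456 ∷ 0x1246 ∷ 0x0145 ∷ 0x0357 ∷ 0x0256 ∷ [])) (kill (edge 0x0456))
    (use 2 0x10235467 ∷ use 0 0x01234567 ∷ use 0 0x20135647 ∷ []) ∷
  entry 8 (List.map edge (0x4567 ∷ 0x3456 ∷ 0x1246 ∷ 0x0145 ∷ 0x0357 ∷ 0x0256 ∷ 0x1347 ∷ [])) (kill (edge 0x2367))
    (leaf ∷ []) ∷
  entry 8 (List.map edge (0x4567 ∷ 0x3456 ∷ 0x1246 ∷ 0x0145 ∷ 0x1456 ∷ [])) (kill (edge 0x0456))
    (use 6 0x64501 ∷ use 0 0x01234567 ∷ []) ∷
  entry 8 (List.map edge (0x4567 ∷ 0x3456 ∷ 0x1246 ∷ 0x0145 ∷ 0x1456 ∷ 0x1347 ∷ [])) (kill (edge 0x0146))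
    (use 10 0x3704156 ∷ use 0 0x01234567 ∷ use 0 0x01274563 ∷ []) ∷
  entry 8 (List.map edge (0x4567 ∷ 0x3456 ∷ 0x1246 ∷ 0x0145 ∷ 0x1456 ∷ 0x1347 ∷ 0x2345 ∷ [])) (kill (edge 0x1245))
    (leaf ∷ []) ∷
  entry 7 (List.map edge (0x3456 ∷ 0x2345 ∷ 0x0135 ∷ 0x0134 ∷ [])) (kill (edge 0x0345))
    (use 3 0x40315 ∷ use 0 0x0123456 ∷ []) ∷
  entry 7 (List.map edge (0x3456 ∷ 0x2345 ∷ 0x0135 ∷ 0x0134 ∷ 0x1236 ∷ [])) (kill (edge 0x1345))
    (use 7 0x2603145 ∷ use 0 0x0123456 ∷ []) ∷
  entry 7 (List.map edge (0x3456 ∷ 0x2345 ∷ 0x0135 ∷ 0x0134 ∷ 0x1236 ∷ 0x0236 ∷ [])) (kill (edge 0x0234))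
    (use 0 0x0123456 ∷ use 0 0x1063542 ∷ []) ∷
  entry 7 (List.map edge (0x3456 ∷ 0x2345 ∷ 0x0135 ∷ 0x0134 ∷ 0x1236 ∷ 0x0236 ∷ 0x0234 ∷ [])) (kill (edge 0x0235))
    (leaf ∷ []) ∷
  entry 5 (List.map edge (0x1234 ∷ 0x0123 ∷ 0x0124 ∷ [])) (kill (edge 0x0134))
    (use 16 0x01234 ∷ use 0 0x0123456 ∷ []) ∷
  entry 7 (List.map edge (0x3456 ∷ 0x2345 ∷ 0x2346 ∷ 0x0134 ∷ [])) (kill (edge 0x0234))
    (use 9 0x0123456 ∷ use 3 0x0123456 ∷ use 3 0x0124356 ∷ use 0 0x01234567 ∷ []) ∷
  entry 8 (List.map edge (0x4567 ∷ 0x3456 ∷ 0x3457 ∷ 0x1245 ∷ 0x0367 ∷ [])) (kill (edge 0x1346))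
    (use 2 0x2174536 ∷ use 0 0x01234567 ∷ use 2 0x1265437 ∷ use 2 0x1235467 ∷ []) ∷
  entry 8 (List.map edge (0x4567 ∷ 0x3456 ∷ 0x3457 ∷ 0x1245 ∷ 0x0367 ∷ 0x0457 ∷ [])) (kill (edge 0x1347))
    (use 1 0x2164537 ∷ use 0 0x01234567 ∷ use 1 0x1235467 ∷ []) ∷
  entry 8 (List.map edge (0x4567 ∷ 0x3456 ∷ 0x3457 ∷ 0x1245 ∷ 0x0367 ∷ 0x0457 ∷ 0x0456 ∷ [])) (kill (edge 0x1467))
    (leaf ∷ []) ∷
  entry 7 (List.map edge (0x3456 ∷ 0x2345 ∷ 0x2346 ∷ 0x0134 ∷ 0x1356 ∷ [])) (kill (edge 0x1456))
    (use 3 0x0123456 ∷ use 0 0x0123456 ∷ use 0 0x0123465 ∷ []) ∷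
  entry 7 (List.map edge (0x3456 ∷ 0x2345 ∷ 0x2346 ∷ 0x0134 ∷ 0x1356 ∷ 0x0235 ∷ [])) (kill (edge 0x0356))
    (use 1 0x0123456 ∷ use 6 0x1023465 ∷ use 0 0x0123456 ∷ []) ∷
  entry 7 (List.map edge (0x3456 ∷ 0x2345 ∷ 0x2346 ∷ 0x0134 ∷ 0x1356 ∷ 0x0235 ∷ 0x1245 ∷ [])) (kill (edge 0x1235))
    (leaf ∷ []) ∷
  entry 7 (List.map edge (0x3456 ∷ 0x2345 ∷ 0x2346 ∷ 0x0134 ∷ 0x1356 ∷ 0x0235 ∷ 0x0356 ∷ [])) (kill (edge 0x0456))
    (leaf ∷ []) ∷
  entry 7 (List.map edge (0x3456 ∷ 0x2345 ∷ 0x2346 ∷ 0x0134 ∷ 0x1356 ∷ 0x1456 ∷ [])) (kill (edge 0x1345))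
    (use 7 0x15346 ∷ use 0 0x01234567 ∷ []) ∷
  entry 8 (List.map edge (0x4567 ∷ 0x3456 ∷ 0x3457 ∷ 0x1245 ∷ 0x2467 ∷ 0x2567 ∷ 0x0367 ∷ [])) (kill (edge 0x0456))
    (leaf ∷ []) ∷
  entry 7 (List.map edge (0x3456 ∷ 0x2345 ∷ 0x2346 ∷ 0x0134 ∷ 0x0234 ∷ [])) (kill (edge 0x0345))
    (use 3 0x0123456 ∷ use 0 0x0123456 ∷ use 0 0x0124356 ∷ []) ∷
  entry 7 (List.map edge (0x3456 ∷ 0x2345 ∷ 0x2346 ∷ 0x0134 ∷ 0x0234 ∷ 0x1236 ∷ [])) (kill (edge 0x1234))
    (use 1 0x0123456 ∷ use 0 0x0123456 ∷ []) ∷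
  entry 7 (List.map edge (0x3456 ∷ 0x2345 ∷ 0x2346 ∷ 0x0134 ∷ 0x0234 ∷ 0x1236 ∷ 0x0356 ∷ [])) (kill (edge 0x0236))
    (leaf ∷ []) ∷
  entry 7 (List.map edge (0x3456 ∷ 0x2345 ∷ 0x2346 ∷ 0x0134 ∷ 0x0234 ∷ 0x1236 ∷ 0x1234 ∷ [])) (kill (edge 0x1246))
    (leaf ∷ []) ∷
  entry 7 (List.map edge (0x3456 ∷ 0x2345 ∷ 0x2346 ∷ 0x0134 ∷ 0x0234 ∷ 0x0345 ∷ [])) (kill (edge 0x1346))
    (use 0 0x0123456 ∷ use 1 0x03245 ∷ use 1 0x04235 ∷ []) ∷
  entry 7 (List.map edge (0x3456 ∷ 0x2345 ∷ 0x2346 ∷ 0x0134 ∷ 0x0234 ∷ 0x0345 ∷ 0x1346 ∷ [])) (kill (edge 0x0346))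
    (leaf ∷ []) ∷
  entry 5 (List.map edge (0x1234 ∷ 0x0123 ∷ 0x0124 ∷ 0x0134 ∷ [])) (kill (edge 0x0234))
    (use 0 0x01234 ∷ []) ∷
  entry 5 (List.map edge (0x1234 ∷ 0x0123 ∷ 0x0124 ∷ 0x0134 ∷ 0x0234 ∷ [])) fresh
    (use 0 0x012345 ∷ []) ∷
  entry 6 (List.map edge (0x2345 ∷ 0x1234 ∷ 0x1235 ∷ 0x1245 ∷ 0x1345 ∷ [])) (kill (edge 0x0123))
    (use 0 0x012345 ∷ use 0 0x025634 ∷ use 0 0x063524 ∷ use 0 0x064523 ∷ []) ∷
  entry 6 (List.map edge (0x2345 ∷ 0x1234 ∷ 0x1235 ∷ 0x1245 ∷ 0x1345 ∷ 0x0123 ∷ [])) (kill (edge 0x0124))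
    (use 1 0x012345 ∷ use 0 0x0123456 ∷ use 0 0x0142356 ∷ []) ∷
  entry 7 (List.map edge (0x3456 ∷ 0x2345 ∷ 0x2346 ∷ 0x2356 ∷ 0x2456 ∷ 0x1234 ∷ 0x0246 ∷ [])) (kill (edge 0x0234))
    (leaf ∷ []) ∷
  entry 6 (List.map edge (0x2345 ∷ 0x1234 ∷ 0x1235 ∷ 0x1245 ∷ 0x1345 ∷ 0x0123 ∷ 0x0124 ∷ [])) (kill (edge 0x0134))
    (leaf ∷ []) ∷
  []

abstract
  -- This evaluation is the finite search itself: it runs through all admissible traces of every
  -- entry.
  twin-free-valid : Valid twinFree twin-free-search
  twin-free-valid = from-yes (valid? twinFree twin-free-search)

abstract
  order-7-valid : Valid (order 7) order-7-search
  order-7-valid = from-yes (valid? (order 7) order-7-search)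

abstract
  order-8-valid : Valid (order 8) order-8-search
  order-8-valid = from-yes (valid? (order 8) order-8-search)

-- Local deductions with twins and uncovered vertices

-- Pairs of labels that no edge separates, and labels that lie in no edge.
Law : ℕ → Set
Law k = List (Fin k × Fin k) × List (Fin k)

Legal : Config k → Law k → Subset k → Set
Legal C (τ , υ) t =
  ∣ t ∣ ≤ 4 × All (λ T → ∣ t ∩ T ∣ ≢ 1) C ×
  All (λ (i , j) → lookup t i ≡ lookup t j) τ × All (λ i → lookup t i ≡ false) υ

legal? : ∀ (C : Config k) l t → Dec (Legal C l t)
legal? C (τ , υ) t =
  ∣ t ∣ ≤? 4 ×-dec All.all? (λ T → ¬? (∣ t ∩ T ∣ ≟ 1)) C ×-dec
  All.all? (λ (i , j) → lookup t i Bool.≟ lookup t j) τ ×-dec All.all? (λ i → lookup t i Bool.≟ false) υ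

-- Stands in for a case distinction by hand: that `L` is exhaustive is confirmed by running through
-- all label sets.
Outcomes : Config k → Law k → Query k → List (Subset k) → Set
Outcomes C l q L = ∀ t → Legal C l t → Hits q t → t ∈ L

outcomes? : ∀ (C : Config k) l q L → Dec (Outcomes C l q L)
outcomes? C l q L = all-subsets? λ t → legal? C l t →-dec hits? q t →-dec (t ∈? L)

-- ι lists the labels outside the core that is being extended, τ those among them that have a twin.
Extension : List (Fin k) → List (Fin k) → Config k → Set
Extension ι τ C =
  Uniqueᴸ ι × Uniqueᴸ C ×
  All (λ T → Any (λ i → lookup T i ≡ true) ι) C ×
  All (λ i → Any (λ T → lookup T i ≡ true) C) ι ×
  AllPairs (λ i j → Any (λ T → lookup T i ≢ lookup T j) C ⊎ (i ∈ τ × j ∈ τ)) ι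

extension? : ∀ (ι τ : List (Fin k)) C → Dec (Extension ι τ C)
extension? ι τ C =
  unique? Fin._≟_ ι ×-dec unique? _≟ˢ_ C ×-dec
  All.all? (λ T → Any.any? (λ i → lookup T i Bool.≟ true) ι) C ×-dec
  All.all? (λ i → Any.any? (λ T → lookup T i Bool.≟ true) C) ι ×-dec
  AllPairs.allPairs? (λ i j →
    Any.any? (λ T → ¬? (lookup T i Bool.≟ lookup T j)) C ⊎-dec (Any.any? (i Fin.≟_) τ ×-dec Any.any? (j Fin.≟_) τ)) ι

length-allFin : ∀ k → length (allFin k) ≡ k
length-allFin k = List.length-tabulate {n = k} id

AllPairs-lookup : ∀ {A : Set} {R : A → A → Set} {xs} → AllPairs R xs →
                  ∀ {x y} → x ∈ xs → y ∈ xs → x ≢ y → R x y ⊎ R y x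
AllPairs-lookup (rs ∷ _) (here refl) (here refl) x≢y = contradiction refl x≢y
AllPairs-lookup (rs ∷ _) (here refl) (there y∈)  _   = inj₁ (All.lookup rs y∈)
AllPairs-lookup (rs ∷ _) (there x∈)  (here refl) _   = inj₂ (All.lookup rs x∈)
AllPairs-lookup (_ ∷ rs) (there x∈)  (there y∈)  x≢y = AllPairs-lookup rs x∈ y∈ x≢y

four : Subset 4
four = true ∷ true ∷ true ∷ true ∷ []

-- Cores and their extension

module Growth {n} (G : Hypergraph4 n) (sat : B4Saturated G) where
  open Saturated G sat

  Covered : Fin n → Set
  Covered v = Any (λ A → lookup A v ≡ true) E

  covered? : ∀ v → Dec (Covered v)
  covered? v = Any.any? (λ A → lookup A v Bool.≟ true) E

  uncovered : ∀ {v} → ¬ Covered v → ∀ {D} → D ∈ E → lookup D v ≡ false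
  uncovered {v} ¬c {D} D∈E with lookup D v in eq
  ... | false = refl
  ... | true  = contradiction (lose D∈E eq) ¬c

  Agree : Fin n → Fin n → Set
  Agree u v = All (λ A → lookup A u ≡ lookup A v) E

  agree? : ∀ u v → Dec (Agree u v)
  agree? u v = All.all? (λ A → lookup A u Bool.≟ lookup A v) E

  distinguishing-edge : ∀ {u v} → ¬ Agree u v → ∃[ D ] D ∈ E × lookup D u ≢ lookup D v
  distinguishing-edge {u} {v} ¬a =
    find (All.¬All⇒Any¬ (λ A → lookup A u Bool.≟ lookup A v) E ¬a)

  Twin : Fin n → Fin n → Set
  Twin u v = u ≢ v × Covered u × Agree u v

  twin? : ∀ u v → Dec (Twin u v)
  twin? u v = ¬? (u Fin.≟ v) ×-dec covered? u ×-dec agree? u v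

  twin-sym : ∀ {u v} → Twin u v → Twin v u
  twin-sym (u≢v , c , a) with A , A∈E , u∈A ← find c =
    u≢v ∘ sym , lose A∈E (trans (sym (All.lookup a A∈E)) u∈A) , All.map sym a

  -- Vertices that no edge of F separates may still not be twins; settled only asks that each has some twin.
  record Core (d : ℕ) : Set where
    field
      X        : List (Fin n)
      F        : List (Subset n)
      X-unique : Uniqueᴸ X
      F-unique : Uniqueᴸ F
      F⊆E      : All (_∈ E) F
      inside   : All (λ A → ∀ v → lookup A v ≡ true → v ∈ X) F
      covers   : All (λ v → Any (λ A → lookup A v ≡ true) F) X
      settled  : AllPairs (λ v w → Any (λ A → lookup A v ≢ lookup A w) F ⊎ (Any (Twin v) X × Any (Twin w) X)) X
      size     : length X ≤ d + length F
  open Core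

  empty : Core 0
  empty = record { X = [] ; F = [] ; X-unique = [] ; F-unique = [] ; F⊆E = [] ; inside = []
                 ; covers = [] ; settled = [] ; size = z≤n }

  realising-edges : ∀ {φ : Vec (Fin n) k} {C : Config k} →
                    All (λ T → ∣ T ∣ ≡ 4 × ∃[ A ] A ∈ E × trace φ A ≡ T) C →
                    ∃[ N ] List.map (trace φ) N ≡ C × All (_∈ E) N
  realising-edges []                            = [] , refl , []
  realising-edges ((_ , A , A∈E , refl) ∷ real) =
    let N , eq , N⊆E = realising-edges real in A ∷ N , cong (trace _ A ∷_) eq , A∈E ∷ N⊆E

  -- Each new edge contains a new vertex, hence differs from the old edges, which lie inside the
  -- core. An old vertex is covered by an old edge, and this edge separates it from every new
  -- vertex. The deficit rises by at most the number of new vertices minus the number of new edges.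
  extend : ∀ {d d′} (core : Core d) {φ : Vec (Fin n) k} {C : Config k} (ι τ : List (Fin k)) →
           Realised φ C → Extension ι τ C →
           All (λ i → lookup φ i ∉ X core) ι → (∀ i → i ∈ ι ⊎ lookup φ i ∈ X core) →
           All (λ i → Any (λ j → Twin (lookup φ i) (lookup φ j)) ι) τ →
           length ι + d ≤ length C + d′ →
           ∃[ core′ ] X {d′} core′ ≡ List.map (lookup φ) ι ++ X core
  extend {k} {d} {d′} core {φ} ι τ (uφ , real) (uι , uC , meets , covered , sep) new place twins count
    with N , refl , N⊆E ← realising-edges real = record
      { X        = Y ++ X core
      ; F        = N ++ F core
      ; X-unique = Uniqueᴸ.++⁺ (Uniqueᴸ.map⁺ (Unique.lookup-injective uφ _ _) uι) (X-unique core)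
                     λ (v∈Y , v∈X) → Y∉X v∈Y v∈X
      ; F-unique = Uniqueᴸ.++⁺ (AllPairs.map (_∘ cong (trace φ)) (AllPairs.map⁻ uC)) (F-unique core)
                     λ (A∈N , A∈F) → N∉F A∈N A∈F
      ; F⊆E      = All.++⁺ N⊆E (F⊆E core)
      ; inside   = All.++⁺ (All.tabulate insideN)
                     (All.map (λ A⊆X v v∈A → ∈-++⁺ʳ Y (A⊆X v v∈A)) (inside core))
      ; covers   = All.++⁺ (All.map⁺ (All.map (λ {i} → Any.++⁺ˡ ∘ Any.map (trans (sym (lookup-map i _ φ))) ∘ Any.map⁻) covered))
                     (All.map (Any.++⁺ʳ N) (covers core))
      ; settled  = AllPairs.++⁺ (AllPairs.map⁺ (AllPairs.map settledY sep))
                     (AllPairs.map settledX (settled core))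
                     (All.map⁺ (All.map (λ {i} φᵢ∉X → All.tabulate λ w∈X → inj₁ (Any.++⁺ʳ N (apart φᵢ∉X w∈X))) new))
      ; size     = sizes
      } , refl
    where
    Y : List (Fin n)
    Y = List.map (lookup φ) ι
    Y∉X : ∀ {v} → v ∈ Y → v ∉ X core
    Y∉X v∈Y with i , i∈ι , refl ← ∈-map⁻ (lookup φ) v∈Y = All.lookup new i∈ι
    at : ∀ A {b} i → lookup (trace φ A) i ≡ b → lookup A (lookup φ i) ≡ b
    at A i = trans (sym (lookup-map i (lookup A) φ))
    N∉F : ∀ {A} → A ∈ N → A ∉ F core
    N∉F {A} A∈N A∈F with i , i∈ι , v∈A ← find (All.lookup (All.map⁻ meets) A∈N) =
      All.lookup new i∈ι (All.lookup (inside core) A∈F _ (at A i v∈A))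
    insideN : ∀ {A} → A ∈ N → ∀ v → lookup A v ≡ true → v ∈ Y ++ X core
    insideN {A} A∈N v v∈A with fresh? v φ
    -- The trace of a new edge is full, so the edge has no unlabelled vertex.
    ... | yes v∉φ = contradiction (trans (sym v∈A) (trace-full-fresh uφ {A}
          (trans (All.lookup (All.map⁻ (All.map proj₁ real)) A∈N) (sym (∣edge∣ (All.lookup N⊆E A∈N)))) v∉φ)) λ ()
    ... | no  v∈φ with i , refl ← not-fresh φ v∈φ | place i
    ...   | inj₁ i∈ι = ∈-++⁺ˡ (∈-map⁺ (lookup φ) i∈ι)
    ...   | inj₂ v∈X = ∈-++⁺ʳ Y v∈X
    partner : ∀ {i} → i ∈ τ → Any (Twin (lookup φ i)) (Y ++ X core)
    partner i∈τ = Any.++⁺ˡ (Any.map⁺ (All.lookup twins i∈τ))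
    Settled : Fin n → Fin n → Set
    Settled v w = Any (λ A → lookup A v ≢ lookup A w) (N ++ F core)
                ⊎ (Any (Twin v) (Y ++ X core) × Any (Twin w) (Y ++ X core))
    settledY : ∀ {i j} → Any (λ T → lookup T i ≢ lookup T j) (List.map (trace φ) N) ⊎ (i ∈ τ × j ∈ τ) →
               Settled (lookup φ i) (lookup φ j)
    settledY {i} {j} (inj₁ s) = inj₁ (Any.++⁺ˡ (Any.map
      (λ s eq → s (trans (lookup-map i _ φ) (trans eq (sym (lookup-map j _ φ))))) (Any.map⁻ s)))
    settledY (inj₂ (i∈τ , j∈τ)) = inj₂ (partner i∈τ , partner j∈τ)
    settledX : ∀ {v w} → Any (λ A → lookup A v ≢ lookup A w) (F core) ⊎ (Any (Twin v) (X core) × Any (Twin w) (X core)) →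
               Settled v w
    settledX (inj₁ s)       = inj₁ (Any.++⁺ʳ N s)
    settledX (inj₂ (p , q)) = inj₂ (Any.++⁺ʳ Y p , Any.++⁺ʳ Y q)
    apart : ∀ {v w} → v ∉ X core → w ∈ X core → Any (λ A → lookup A v ≢ lookup A w) (F core)
    apart v∉X w∈X with A , A∈F , w∈A ← find (All.lookup (covers core) w∈X) =
      lose A∈F λ eq → v∉X (All.lookup (inside core) A∈F _ (trans eq w∈A))
    sizes : length (Y ++ X core) ≤ d′ + length (N ++ F core)
    sizes = begin
      length (Y ++ X core)                  ≡⟨ List.length-++ Y ⟩
      length Y + length (X core)            ≡⟨ cong (_+ length (X core)) (List.length-map (lookup φ) ι) ⟩
      length ι + length (X core)            ≤⟨ +-monoʳ-≤ (length ι) (size core) ⟩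
      length ι + (d + length (F core))      ≡⟨ +-assoc (length ι) d _ ⟨
      length ι + d + length (F core)        ≤⟨ +-monoˡ-≤ _ count ⟩
      length (List.map (trace φ) N) + d′ + length (F core) ≡⟨ cong (_+ length (F core)) (+-comm _ d′) ⟩
      d′ + length (List.map (trace φ) N) + length (F core) ≡⟨ cong (λ m → d′ + m + length (F core)) (List.length-map (trace φ) N) ⟩
      d′ + length N + length (F core)       ≡⟨ +-assoc d′ (length N) _ ⟩
      d′ + (length N + length (F core))     ≡⟨ cong (d′ +_) (List.length-++ N) ⟨
      d′ + length (N ++ F core)             ∎
      where open ≤-Reasoning

  _⊨_ : Vec (Fin n) k → Law k → Set
  φ ⊨ (τ , υ) = All (λ (i , j) → Agree (lookup φ i) (lookup φ j)) τ × All (λ i → ¬ Covered (lookup φ i)) υ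

  legal : ∀ {φ : Vec (Fin n) k} {C l D} → Realised φ C → φ ⊨ l → D ∈ E → Legal C l (trace φ D)
  legal {φ = φ} {D = D} real@(uφ , _) (tw , un) D∈E =
    small-trace uφ D∈E , legal-trace real D∈E ,
    All.map (λ {(i , j)} a → trans (lookup-map i _ φ) (trans (All.lookup a D∈E) (sym (lookup-map j _ φ)))) tw ,
    All.map (λ {i} ¬c → trans (lookup-map i _ φ) (uncovered ¬c D∈E)) un

  -- The implicit certificate is found by evaluation; what remains for the caller is to treat the
  -- few traces in `L`.
  killer : ∀ {φ : Vec (Fin n) k} {C} l → Realised φ C → φ ⊨ l → (S : Subset k) → ∣ S ∣ ≡ 4 →
           (L : List (Subset k)) → {True (outcomes? C l (kill S) L)} → ∃[ D ] D ∈ E × trace φ D ∈ L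
  killer l real@(uφ , _) law S ∣S∣ L {ok} with D , D∈E , hit ← killed uφ S ∣S∣ =
    D , D∈E , toWitness ok _ (legal real law D∈E) hit

  splitter : ∀ {φ : Vec (Fin n) k} {C} l → Realised φ C → φ ⊨ l → ∀ i j → ¬ Agree (lookup φ i) (lookup φ j) →
             (L : List (Subset k)) → {True (outcomes? C l (split i j) L)} → ∃[ D ] D ∈ E × trace φ D ∈ L
  splitter {φ = φ} l real law i j ¬a L {ok} with D , D∈E , sep ← distinguishing-edge ¬a =
    D , D∈E , toWitness ok _ (legal real law D∈E)
      (λ eq → sep (trans (sym (lookup-map i (lookup D) φ)) (trans eq (lookup-map j (lookup D) φ))))

  add₀ : ∀ {φ : Vec (Fin n) k} {C t D} → Realised φ C → D ∈ E → trace φ D ≡ t → ∣ t ∣ ≡ 4 → Realised φ (t ∷ C)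
  add₀ (uφ , real) D∈E eq full = uφ , (full , _ , D∈E , eq) ∷ real

  add₁ : ∀ {φ : Vec (Fin n) k} {C t D} → Realised φ C → D ∈ E → trace φ D ≡ t → ∣ t ∣ ≡ 3 →
         ∃[ v ] Realised (v ∷ φ) ((true ∷ t) ∷ List.map (false ∷_) C)
  add₁ {D = D} real@(uφ , _) D∈E refl three
    with v , v∉φ , v∈D ← next-vertex {D = D} {j = 0} uφ D∈E (cong (_+ 1) three)
    = v , add₀ (fresh-realised v∉φ real) D∈E (cong (_∷ _) v∈D) (cong suc three)

  add₂ : ∀ {φ : Vec (Fin n) k} {C t D} → Realised φ C → D ∈ E → trace φ D ≡ t → ∣ t ∣ ≡ 2 →
         ∃[ w ] ∃[ v ] Realised (w ∷ v ∷ φ) ((true ∷ true ∷ t) ∷ List.map (false ∷_) (List.map (false ∷_) C))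
  add₂ {D = D} real@(uφ , _) D∈E refl two
    with v , v∉φ , v∈D ← next-vertex {D = D} {j = 1} uφ D∈E (cong (_+ 2) two)
    with w , real′ ← add₁ (fresh-realised v∉φ real) D∈E (cong (_∷ _) v∈D) (cong suc two)
    = w , v , real′

  -- When no legal trace blocks `S`, saturation leaves only the possibility that `S` is an edge.
  forced : ∀ {φ : Vec (Fin n) k} {C} l S → Realised φ C → φ ⊨ l → {True (∣ S ∣ ≟ 4)} →
           {True (outcomes? C l (kill S) (S ∷ []))} → Realised φ (S ∷ C)
  forced {φ = φ} {C} l S real law {∣S∣} {ok} = add (killer l real law S (toWitness ∣S∣) (S ∷ []) {ok})
    where
    add : ∃[ D ] D ∈ E × trace φ D ∈ S ∷ [] → Realised φ (S ∷ C)
    add (D , D∈E , here eq) = add₀ real D∈E eq (toWitness ∣S∣)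

  relabel : ∀ {j} {φ : Vec (Fin n) k} {C} → Realised φ C → (ρ : Vec (Fin k) j) (C₀ : Config j) →
            {True (embeds? C ρ C₀)} → Realised (map (lookup φ) ρ) C₀
  relabel real ρ C₀ {ok} = embedded (toWitness ok) real

  complete₂ : ∀ {A u v} → A ∈ E → u ≢ v → lookup A u ≡ true → lookup A v ≡ true →
              ∃[ x ] ∃[ y ] Realised (x ∷ y ∷ u ∷ v ∷ []) (four ∷ [])
  complete₂ A∈E u≢v u∈A v∈A =
    add₂ (((u≢v ∷ []) ∷ [] ∷ []) , []) A∈E (cong₂ (λ a b → a ∷ b ∷ []) u∈A v∈A) refl

  complete₁ : ∀ {A u} → A ∈ E → lookup A u ≡ true →
              ∃[ x ] ∃[ y ] ∃[ z ] Realised (x ∷ y ∷ z ∷ u ∷ []) (four ∷ [])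
  complete₁ {A} {u} A∈E u∈A
    with z , z≢u ∷ [] , z∈A ← next-vertex {φ = u ∷ []} {D = A} {j = 2} ([] ∷ []) A∈E (cong (λ b → ∣ b ∷ [] ∣ + 3) u∈A)
    with x , y , real ← complete₂ A∈E z≢u z∈A u∈A
    = x , y , z , real

  -- With labels in the order z, x, y, p, q, the pair pq is joined to each side of the triangle xyz.
  Triangle : Config 5
  Triangle = (true ∷ false ∷ true ∷ true ∷ true ∷ []) ∷ (true ∷ true ∷ false ∷ true ∷ true ∷ [])
           ∷ (false ∷ true ∷ true ∷ true ∷ true ∷ []) ∷ []

  -- An edge separating x, y contains p and q, say it is xzpq; then nothing can block yzpq.
  triangle : ∀ {x y p q} → Realised (x ∷ y ∷ p ∷ q ∷ []) (four ∷ []) →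
             Agree p q → ¬ Agree x y → ∃[ z ] Realised (z ∷ x ∷ y ∷ p ∷ q ∷ []) Triangle
  triangle {x} {y} {p} {q} real pq ¬xy = by-cases
    (splitter ((# 2 , # 3) ∷ [] , []) real (pq ∷ [] , []) (# 0) (# 1) ¬xy
      ((true ∷ false ∷ true ∷ true ∷ []) ∷ (false ∷ true ∷ true ∷ true ∷ []) ∷ []))
    where
    by-cases : ∃[ D ] D ∈ E × trace (x ∷ y ∷ p ∷ q ∷ []) D ∈
                 (true ∷ false ∷ true ∷ true ∷ []) ∷ (false ∷ true ∷ true ∷ true ∷ []) ∷ [] →
               ∃[ z ] Realised (z ∷ x ∷ y ∷ p ∷ q ∷ []) Triangle
    by-cases (D , D∈E , here eq) =
      let z , real = add₁ real D∈E eq refl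
      in z , relabel (forced ((# 3 , # 4) ∷ [] , []) (true ∷ false ∷ true ∷ true ∷ true ∷ []) real (pq ∷ [] , []))
                     (# 0 ∷ # 1 ∷ # 2 ∷ # 3 ∷ # 4 ∷ []) Triangle
    by-cases (D , D∈E , there (here eq)) =
      let z , real = add₁ real D∈E eq refl
      in z , relabel (forced ((# 3 , # 4) ∷ [] , []) (true ∷ true ∷ false ∷ true ∷ true ∷ []) real (pq ∷ [] , []))
                     (# 0 ∷ # 1 ∷ # 2 ∷ # 3 ∷ # 4 ∷ []) Triangle

  NoTwins : Set
  NoTwins = ∀ u v → ¬ Twin u v

  NoTwoPairs : Set
  NoTwoPairs = ∀ {p q r s} → Unique (p ∷ q ∷ r ∷ s ∷ []) → Twin p q → Twin r s → ⊥

  -- An edge with two new twin vertices is absorbed with the help of a twin pair of the core that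
  -- avoids it. With `two` such a pair is always at hand; with `none` or `one` such an edge cannot
  -- occur.
  data Anchor (Z : List (Fin n)) : Set where
    none : NoTwins → Anchor Z
    one  : ∀ {p q} → p ∈ Z → q ∈ Z → Twin p q → NoTwoPairs → Anchor Z
    two  : ∀ {p q r s} → p ∈ Z → q ∈ Z → r ∈ Z → s ∈ Z → Unique (p ∷ q ∷ r ∷ s ∷ []) →
           Twin p q → Twin r s → Anchor Z

  anchor-mono : ∀ {Z Z′} → (∀ {v} → v ∈ Z → v ∈ Z′) → Anchor Z → Anchor Z′
  anchor-mono sub (none nt)                   = none nt
  anchor-mono sub (one p q tw nt)             = one (sub p) (sub q) tw nt
  anchor-mono sub (two p q r s u tw tw′)      = two (sub p) (sub q) (sub r) (sub s) u tw tw′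

  Grown : ∀ {d} → Core d → Set
  Grown {d} core = ∃[ core′ ] (∀ {v} → v ∈ X core → v ∈ X {d} core′) × length (X core) < length (X core′)

  attach : ∀ {d} (core : Core d) {φ : Vec (Fin n) k} {C : Config k} ι τ → Realised φ C →
           {True (extension? ι τ C)} →
           All (λ i → lookup φ i ∉ X core) ι → (∀ j → j ∈ ι ⊎ lookup φ j ∈ X core) →
           All (λ i → Any (λ j → Twin (lookup φ i) (lookup φ j)) ι) τ →
           length ι + d ≤ length C + d → 0 < length ι → Grown core
  attach core {φ} ι τ real {ok} new place twins count pos
    with core′ , eq ← extend core ι τ real (toWitness ok) new place twins count
    = core′ , (λ v∈X → subst (_ ∈_) (sym eq) (∈-++⁺ʳ (List.map (lookup φ) ι) v∈X)) , (begin-strict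
      length (X core)                            <⟨ m<n+m (length (X core)) pos ⟩
      length ι + length (X core)                 ≡⟨ cong (_+ length (X core)) (List.length-map (lookup φ) ι) ⟨
      length (List.map (lookup φ) ι) + length (X core) ≡⟨ List.length-++ (List.map (lookup φ) ι) ⟨
      length (List.map (lookup φ) ι ++ X core)   ≡⟨ cong length eq ⟨
      length (X core′)                           ∎)
    where open ≤-Reasoning

  four-members : ∀ {φ : Vec (Fin n) 4} → Unique φ → ∀ {A} → A ∈ E → trace φ A ≡ four →
                 ∀ {v} → lookup A v ≡ true → ∃[ i ] lookup φ i ≡ v
  four-members {φ} uφ {A} A∈E eq {v} v∈A with fresh? v φ
  ... | no  v∈φ = not-fresh φ v∈φ
  ... | yes v∉φ = contradiction (trans (sym v∈A)
        (trace-full-fresh uφ {A} (trans (cong ∣_∣ eq) (sym (∣edge∣ A∈E))) v∉φ)) λ ()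

  members : ∀ {x y a b : Fin n} {A} → trace (x ∷ y ∷ a ∷ b ∷ []) A ≡ four →
            Allⱽ (λ w → lookup A w ≡ true) (x ∷ y ∷ a ∷ b ∷ [])
  members eq = cong (λ t → lookup t (# 0)) eq ∷ cong (λ t → lookup t (# 1)) eq
             ∷ cong (λ t → lookup t (# 2)) eq ∷ cong (λ t → lookup t (# 3)) eq ∷ []

  twin-covered : ∀ {φ : Vec (Fin n) k} {C} → Realised φ C → ∀ i → Any (λ T → lookup T i ≡ true) C →
                 Covered (lookup φ i)
  twin-covered {φ = φ} (_ , real) i cov with T , T∈C , v∈T ← find cov
    with _ , A , A∈E , refl ← All.lookup real T∈C = lose A∈E (trans (sym (lookup-map i _ φ)) v∈T)

  outside-core : ∀ {d} (core : Core d) {B v} → B ∈ F core → v ∉ X core → lookup B v ≡ false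
  outside-core core {B} {v} B∈F v∉X with lookup B v in eq
  ... | false = refl
  ... | true  = contradiction (All.lookup (inside core) B∈F v eq) v∉X

  -- Growth along an edge that leaves the core

  module _ {d} (core : Core d) (anchor : Anchor (X core)) where

    private
      Old New : Fin n → Set
      Old v = v ∈ X core
      New v = v ∉ X core

    grow-one : ∀ {x a b c} → Realised (x ∷ a ∷ b ∷ c ∷ []) (four ∷ []) → New x → Old a → Old b → Old c → Grown core
    grow-one real x a b c = attach core (# 0 ∷ []) [] real
        (x ∷ [])
      (λ { zero → inj₁ (here refl) ; (suc zero) → inj₂ a ; (suc (suc zero)) → inj₂ b ; (suc (suc (suc zero))) → inj₂ c })
      [] ≤-refl (s≤s z≤n)

    -- The core edge that covers `a` lies inside the core and would form a bow tie with the given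
    -- edge.
    grow-none : ∀ {x y z a} → Realised (x ∷ y ∷ z ∷ a ∷ []) (four ∷ []) → New x → New y → New z → Old a → ⊥
    grow-none real x y z a with B , B∈F , a∈B ← find (All.lookup (covers core) a) =
      All.lookup (legal-trace real (All.lookup (F⊆E core) B∈F)) (here refl) (single
        (outside-core core B∈F x) (outside-core core B∈F y) (outside-core core B∈F z) a∈B)
      where
      single : ∀ {x y z a} → x ≡ false → y ≡ false → z ≡ false → a ≡ true → ∣ (x ∷ y ∷ z ∷ a ∷ []) ∩ four ∣ ≡ 1
      single refl refl refl refl = refl

    -- An edge of the core containing just one of a, b would meet the edge abxy in one vertex.
    pair-twins : ∀ {x y a b} → Realised (x ∷ y ∷ a ∷ b ∷ []) (four ∷ []) → New x → New y → Old a → Old b → Agree a b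
    pair-twins {x} {y} {a} {b} real@(((_ ∷ x≢a ∷ x≢b ∷ []) ∷ (y≢a ∷ y≢b ∷ []) ∷ (a≢b ∷ []) ∷ _) , (_ , A , A∈E , eq) ∷ []) nx ny oa ob
      = by-cases (AllPairs-lookup (settled core) oa ob a≢b)
      where
      single : ∀ {x y a b} → x ≡ false → y ≡ false → a ≢ b → ∣ (x ∷ y ∷ a ∷ b ∷ []) ∩ four ∣ ≡ 1
      single {a = false} {false} refl refl a≢b = contradiction refl a≢b
      single {a = false} {true}  refl refl a≢b = refl
      single {a = true}  {false} refl refl a≢b = refl
      single {a = true}  {true}  refl refl a≢b = contradiction refl a≢b
      unseparated : ¬ Any (λ B → lookup B a ≢ lookup B b) (F core)
      unseparated sep with B , B∈F , a≢b ← find sep =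
        All.lookup (legal-trace real (All.lookup (F⊆E core) B∈F)) (here refl)
          (single (outside-core core B∈F nx) (outside-core core B∈F ny) a≢b)
      -- A twin of `a` lies on the edge together with `a`. Belonging to the core, it is neither `x`
      -- nor `y`, so it is `b`.
      partnered : Any (Twin a) (X core) → Agree a b
      partnered tw with a′ , a′∈X , a≢a′ , _ , agree ← find tw = found agree (four-members (proj₁ real) A∈E eq a′∈A)
        where
        a′∈A : lookup A a′ ≡ true
        a′∈A = trans (sym (All.lookup agree A∈E)) (cong (λ t → lookup t (# 2)) eq)
        found : Agree a a′ → ∃[ i ] lookup (x ∷ y ∷ a ∷ b ∷ []) i ≡ a′ → Agree a b
        found _  (zero                , refl) = contradiction a′∈X nx
        found _  (suc zero            , refl) = contradiction a′∈X ny
        found _  (suc (suc zero)      , refl) = contradiction refl a≢a′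
        found ag (suc (suc (suc zero)) , refl) = ag
      Settled : Fin n → Fin n → Set
      Settled v w = Any (λ B → lookup B v ≢ lookup B w) (F core) ⊎ (Any (Twin v) (X core) × Any (Twin w) (X core))
      by-cases : Settled a b ⊎ Settled b a → Agree a b
      by-cases (inj₁ (inj₁ sep))      = contradiction sep unseparated
      by-cases (inj₂ (inj₁ sep))      = contradiction (Any.map (_∘ sym) sep) unseparated
      by-cases (inj₁ (inj₂ (tw , _))) = partnered tw
      by-cases (inj₂ (inj₂ (_ , tw))) = partnered tw

    -- All three edges from `triangle` contain `x` or `y`, so they are new. They pay for `x`, `y`
    -- and, if it lies outside the core, also for `z`.
    grow-fan : ∀ {x y a b} → Realised (x ∷ y ∷ a ∷ b ∷ []) (four ∷ []) → New x → New y → Old a → Old b →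
               Agree a b → ¬ Agree x y → Grown core
    grow-fan real₀ x y a b ab ¬xy with z , real ← triangle real₀ ab ¬xy with Any.any? (z Fin.≟_) (X core)
    ... | yes z = attach core (# 1 ∷ # 2 ∷ []) [] real
        (x ∷ y ∷ [])
      (λ { zero → inj₂ z ; (suc zero) → inj₁ (here refl) ; (suc (suc zero)) → inj₁ (there (here refl))
         ; (suc (suc (suc zero))) → inj₂ a ; (suc (suc (suc (suc zero)))) → inj₂ b })
      [] (n≤1+n _) (s≤s z≤n)
    ... | no  z = attach core (# 0 ∷ # 1 ∷ # 2 ∷ []) [] real
        (z ∷ x ∷ y ∷ [])
      (λ { zero → inj₁ (here refl) ; (suc zero) → inj₁ (there (here refl)) ; (suc (suc zero)) → inj₁ (there (there (here refl)))
         ; (suc (suc (suc zero))) → inj₂ a ; (suc (suc (suc (suc zero)))) → inj₂ b })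
      [] ≤-refl (s≤s z≤n)

    -- The twin pairs rs and xy form an edge, which together with xyab pays for the two new
    -- vertices. These count as settled because each is a twin of the other.
    grow-twins : ∀ {x y a b r s} → Realised (r ∷ s ∷ x ∷ y ∷ a ∷ b ∷ []) ((false ∷ false ∷ four) ∷ []) →
                 New x → New y → Old a → Old b → Old r → Old s → Agree r s → Twin x y → Grown core
    grow-twins real x y a b r s rs xy@(_ , _ , agree) =
      attach core (# 2 ∷ # 3 ∷ []) (# 2 ∷ # 3 ∷ [])
        (forced ((# 0 , # 1) ∷ (# 2 , # 3) ∷ [] , []) (true ∷ true ∷ true ∷ true ∷ false ∷ false ∷ []) real
          (rs ∷ agree ∷ [] , []))
        (x ∷ y ∷ [])
        (λ { zero → inj₂ r ; (suc zero) → inj₂ s ; (suc (suc zero)) → inj₁ (here refl) ; (suc (suc (suc zero))) → inj₁ (there (here refl))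
           ; (suc (suc (suc (suc zero)))) → inj₂ a ; (suc (suc (suc (suc (suc zero))))) → inj₂ b })
        (there (here xy) ∷ here (twin-sym xy) ∷ []) ≤-refl (s≤s z≤n)

    grow-two : ∀ {x y a b} → Realised (x ∷ y ∷ a ∷ b ∷ []) (four ∷ []) → New x → New y → Old a → Old b → Grown core
    grow-two {x} {y} {a} {b} real@(((x≢y ∷ _) ∷ _ ∷ (a≢b ∷ []) ∷ _) , (_ , A , A∈E , eq) ∷ []) nx ny oa ob
      = by-cases (pair-twins real nx ny oa ob) (agree? x y)
      where
      with-pair : Twin x y → ∀ {r s} → Twin r s → Old r → Old s → lookup A r ≡ false → Grown core
      with-pair x-y {r} {s} (r≢s , _ , rs) r∈X s∈X r∉A = grow-twins
        (fresh-realised (r≢s ∷ avoids r∉A) (fresh-realised (avoids (trans (sym (All.lookup rs A∈E)) r∉A)) real))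
        nx ny oa ob r∈X s∈X rs x-y
        where
        avoids : ∀ {v} → lookup A v ≡ false → Fresh v (x ∷ y ∷ a ∷ b ∷ [])
        avoids v∉A = Allⱽ.map (λ w∈A v≡w → contradiction (trans (sym w∈A) (trans (cong (lookup A) (sym v≡w)) v∉A)) λ ()) (members {A = A} eq)
      old-member : ∀ {v} → Old v → lookup A v ≡ true → v ≡ a ⊎ v ≡ b
      old-member v∈X v∈A with four-members (proj₁ real) A∈E eq v∈A
      ... | zero                 , refl = contradiction v∈X nx
      ... | suc zero             , refl = contradiction v∈X ny
      ... | suc (suc zero)       , refl = inj₁ refl
      ... | suc (suc (suc zero)) , refl = inj₂ refl
      anchored : Twin x y → Twin a b → Anchor (X core) → Grown core
      anchored x-y a-b (none nt)      = ⊥-elim (nt _ _ x-y)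
      anchored x-y a-b (one _ _ _ nt) = ⊥-elim (nt (proj₁ (relabel real (# 2 ∷ # 3 ∷ # 0 ∷ # 1 ∷ []) (four ∷ []))) a-b x-y)
      anchored x-y a-b (two {p} {q} {r} {s} p∈X q∈X r∈X s∈X ((p≢q ∷ p≢r ∷ _) ∷ (q≢r ∷ _) ∷ _) pq rs)
        with lookup A p in p∈A | lookup A r in r∈A
      ... | false | _     = with-pair x-y pq p∈X q∈X p∈A
      ... | true  | false = with-pair x-y rs r∈X s∈X r∈A
      -- If both pairs met the edge, the three different core vertices `p`, `q`, `r` would lie on
      -- it, but its only core vertices are `a` and `b`.
      ... | true  | true  = ⊥-elim (three (old-member p∈X p∈A) (old-member q∈X (trans (sym (All.lookup (proj₂ (proj₂ pq)) A∈E)) p∈A)) (old-member r∈X r∈A))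
        where
        three : p ≡ a ⊎ p ≡ b → q ≡ a ⊎ q ≡ b → r ≡ a ⊎ r ≡ b → ⊥
        three (inj₁ refl) (inj₁ refl) _           = p≢q refl
        three (inj₁ refl) (inj₂ refl) (inj₁ refl) = p≢r refl
        three (inj₁ refl) (inj₂ refl) (inj₂ refl) = q≢r refl
        three (inj₂ refl) (inj₁ refl) (inj₁ refl) = q≢r refl
        three (inj₂ refl) (inj₁ refl) (inj₂ refl) = p≢r refl
        three (inj₂ refl) (inj₂ refl) _           = p≢q refl
      by-cases : Agree a b → Dec (Agree x y) → Grown core
      by-cases ab (no ¬xy) = grow-fan real nx ny oa ob ab ¬xy
      by-cases ab (yes xy) = anchored (x≢y , twin-covered real (# 0) (here refl) , xy)
                                      (a≢b , twin-covered real (# 2) (here refl) , ab) anchor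

    grow : ∀ {A a x} → A ∈ E → lookup A a ≡ true → lookup A x ≡ true → Old a → New x → Grown core
    grow {A} {a} {x} A∈E a∈A x∈A oa nx
      with y , z , real ← complete₂ A∈E (λ { refl → nx oa }) x∈A a∈A
      with Any.any? (y Fin.≟_) (X core) | Any.any? (z Fin.≟_) (X core)
    ... | yes oy | yes oz = grow-one (relabel real (# 2 ∷ # 0 ∷ # 1 ∷ # 3 ∷ []) (four ∷ [])) nx oy oz oa
    ... | yes oy | no  nz = grow-two (relabel real (# 2 ∷ # 1 ∷ # 0 ∷ # 3 ∷ []) (four ∷ [])) nx nz oy oa
    ... | no  ny | yes oz = grow-two (relabel real (# 2 ∷ # 0 ∷ # 1 ∷ # 3 ∷ []) (four ∷ [])) nx ny oz oa
    ... | no  ny | no  nz = ⊥-elim (grow-none real ny nz nx oa)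

  -- A twin pair outside would form an edge with a twin pair of the core, and this edge would cross
  -- the border of a closed core.
  outside-free : ∀ {d} (core : Core d) → Anchor (X core) →
                 (∀ {A a x} → A ∈ E → lookup A a ≡ true → lookup A x ≡ true → a ∈ X core → x ∈ X core) →
                 ∀ {u v} → u ∉ X core → v ∉ X core → ¬ Twin u v
  outside-free core anchor closed {u} {v} u∉X v∉X uv@(u≢v , _ , agree) = by-cases anchor
    where
    apart : ∀ {p w} → p ∈ X core → w ∉ X core → p ≢ w
    apart p∈X w∉X refl = w∉X p∈X
    distinct : ∀ {p q} → p ≢ q → p ∈ X core → q ∈ X core → Unique (p ∷ q ∷ u ∷ v ∷ [])
    distinct p≢q p∈X q∈X =
      (p≢q ∷ apart p∈X u∉X ∷ apart p∈X v∉X ∷ []) ∷ (apart q∈X u∉X ∷ apart q∈X v∉X ∷ []) ∷ (u≢v ∷ []) ∷ [] ∷ []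
    by-cases : Anchor (X core) → ⊥
    by-cases (none nt)                                   = nt u v uv
    by-cases (one p∈X q∈X pq nt)                         = nt (distinct (proj₁ pq) p∈X q∈X) pq uv
    by-cases (two p∈X q∈X _ _ _ (p≢q , _ , pq) _)
      with D , D∈E , here eq ← killer ((# 0 , # 1) ∷ (# 2 , # 3) ∷ [] , [])
             ((distinct p≢q p∈X q∈X) , []) (pq ∷ agree ∷ [] , []) four refl (four ∷ [])
      = u∉X (closed D∈E (cong (λ t → lookup t (# 0)) eq) (cong (λ t → lookup t (# 2)) eq) p∈X)

  -- Components beyond a closed core

  module Outside {d} (core : Core d) (anchor : Anchor (X core))
    (closed : ∀ {A a x} → A ∈ E → lookup A a ≡ true → lookup A x ≡ true → a ∈ X core → x ∈ X core) where

    Q : Fin n → Set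
    Q v = v ∉ X core × Covered v

    Q-closed : ∀ {A u v} → A ∈ E → lookup A u ≡ true → lookup A v ≡ true → Q u → Q v
    Q-closed A∈E u∈A v∈A (u∉X , _) = (λ v∈X → u∉X (closed A∈E v∈A u∈A v∈X)) , lose A∈E v∈A

    open Search Q Q-closed

    no-twins : Hypothesis twinFree
    no-twins u v (u∉X , cu) (v∉X , _) u≢v =
      distinguishing-edge λ agree → outside-free core anchor closed u∉X v∉X (u≢v , cu , agree)

    located : ∀ {x y z w} → Realised (y ∷ z ∷ w ∷ x ∷ []) (four ∷ []) → x ∉ X core → Allⱽ Q (y ∷ z ∷ w ∷ x ∷ [])
    located {x} (_ , (_ , B , B∈E , eq) ∷ []) x∉X with y∈B ∷ z∈B ∷ w∈B ∷ x∈B ∷ [] ← members {A = B} eq =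
      Q-closed B∈E x∈B y∈B Qx ∷ Q-closed B∈E x∈B z∈B Qx ∷ Q-closed B∈E x∈B w∈B Qx ∷ Qx ∷ []
      where
      Qx : Q x
      Qx = x∉X , lose B∈E (cong (λ t → lookup t (# 3)) eq)

    -- All labels of the terminal configuration are new and separated by its own edges, so it joins
    -- the core in one step, with at least as many edges as vertices.
    attach-found : Goal twinFree → Grown core
    attach-found (k , φ , C , Qφ , real@(_ , sizes) , k>0 , k≤C , uC , cov , sep) =
      attach core (allFin k) [] real
        {fromWitness (Uniqueᴸ.allFin⁺ k , uC ,
          All.map (λ { {T} (∣T∣ , _) → let i , Tᵢ = nonempty T (subst (0 <_) (sym ∣T∣) (s≤s z≤n)) in lose (∈-allFin i) Tᵢ }) sizes ,
          All.tabulate (λ {i} _ → cov i) ,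
          AllPairs.map (λ i≢j → inj₁ (sep _ _ i≢j)) (Uniqueᴸ.allFin⁺ k))}
        (All.tabulate (λ {i} _ → proj₁ (Allⱽ.lookup⁺ Qφ i)))
        (λ i → inj₁ (∈-allFin i)) []
        (+-monoˡ-≤ _ (≤-trans (≤-reflexive (length-allFin _)) k≤C))
        (≤-trans k>0 (≤-reflexive (sym (length-allFin _))))

    search : ∀ {φ : Vec (Fin n) 4} → Allⱽ Q φ → Realised φ (four ∷ []) → Goal twinFree
    search = All.head (valid-sound twinFree no-twins twin-free-valid)

    grow-outside : ∀ {A x} → A ∈ E → lookup A x ≡ true → x ∉ X core → Grown core
    grow-outside A∈E x∈A x∉X
      with y , z , w , real ← complete₁ A∈E x∈A
      = attach-found (search (located real x∉X) real)

  Full : ∀ {d} → Core d → Set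
  Full core = ∀ v → Covered v → v ∈ X core

  _∈ᵛ?_ : (v : Fin n) (Z : List (Fin n)) → Dec (v ∈ Z)
  v ∈ᵛ? Z = Any.any? (v Fin.≟_) Z

  -- Edges crossing the border are dealt with first, because the search beyond the core presupposes
  -- that there are none.
  grow-or-full : ∀ {d} (core : Core d) → Anchor (X core) → Grown core ⊎ Full core
  grow-or-full core anchor
    with Any.any? (λ A → Fin.any? λ a → Fin.any? λ x →
           lookup A a Bool.≟ true ×-dec lookup A x Bool.≟ true ×-dec a ∈ᵛ? X core ×-dec ¬? (x ∈ᵛ? X core)) E
  ... | yes crossing with A , A∈E , a , x , a∈A , x∈A , a∈X , x∉X ← find crossing =
    inj₁ (grow core anchor A∈E a∈A x∈A a∈X x∉X)
  ... | no  none-crosses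
    with Any.any? (λ A → Fin.any? λ x → lookup A x Bool.≟ true ×-dec ¬? (x ∈ᵛ? X core)) E
  ...   | yes outside with A , A∈E , x , x∈A , x∉X ← find outside =
    inj₁ (Outside.grow-outside core anchor closed A∈E x∈A x∉X)
    where
    closed : ∀ {A a x} → A ∈ E → lookup A a ≡ true → lookup A x ≡ true → a ∈ X core → x ∈ X core
    closed {x = x} A∈E a∈A x∈A a∈X with x ∈ᵛ? X core
    ... | yes x∈X = x∈X
    ... | no  x∉X = contradiction (lose A∈E (_ , _ , a∈A , x∈A , a∈X , x∉X)) none-crosses
  ...   | no  none-outside = inj₂ full
    where
    full : Full core
    full v c with v ∈ᵛ? X core | find c
    ... | yes v∈X | _               = v∈X
    ... | no  v∉X | A , A∈E , v∈A = contradiction (lose A∈E (v , v∈A , v∉X)) none-outside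

  vertices-bound : ∀ {Z : List (Fin n)} → Uniqueᴸ Z → length Z ≤ n
  vertices-bound uZ = ≤-trans (injection-length uZ (λ {v} _ → ∈-allFin v)) (≤-reflexive (length-allFin n))

  -- `fuel` bounds the number of vertices still missing from the core. Every growth step adds at
  -- least one, and a core cannot have more than `n`.
  saturate : ∀ fuel {d} (core : Core d) → Anchor (X core) → n ≤ length (X core) + fuel →
             ∃[ core′ ] Full {d} core′ × (∀ {v} → v ∈ X core → v ∈ X core′)
  saturate fuel core anchor enough with grow-or-full core anchor
  ... | inj₂ full = core , full , id
  saturate zero core anchor enough | inj₁ (core′ , _ , longer) =
    contradiction (≤-trans longer (vertices-bound (X-unique core′))) (≤⇒≯ (≤-trans enough (≤-reflexive (+-identityʳ _))))
  saturate (suc fuel) core anchor enough | inj₁ (core′ , sub , longer)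
    with core″ , full , sub′ ← saturate fuel core′ (anchor-mono sub anchor)
           (≤-trans enough (≤-trans (≤-reflexive (+-suc _ fuel)) (+-monoˡ-≤ fuel longer)))
    = core″ , full , sub′ ∘ sub

  another : ∀ Z → length Z < n → ∃[ v ] v ∉ Z
  another Z short with Fin.any? (λ v → ¬? (v ∈ᵛ? Z))
  ... | yes found = found
  ... | no  all   = contradiction (≤-trans (≤-reflexive (sym (length-allFin n))) (injection-length (Uniqueᴸ.allFin⁺ n) λ {v} _ → inZ v)) (<⇒≱ short)
    where
    inZ : ∀ v → v ∈ Z
    inZ v with v ∈ᵛ? Z
    ... | yes v∈Z = v∈Z
    ... | no  v∉Z = contradiction (v , v∉Z) all

  core-bound : ∀ {d} (core : Core d) → length (X core) ≤ d + length E
  core-bound {d} core = ≤-trans (size core) (+-monoʳ-≤ d (injection-length (F-unique core) (All.lookup (F⊆E core))))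

  -- Four uncovered vertices would make a 4-set that is disjoint from all edges, hence neither an
  -- edge nor blocked. This is why the list of outcomes is empty.
  few-uncovered : ∀ {d} (core : Core d) → Full core → n ≤ 3 + length (X core)
  few-uncovered core full with n ≤? 3 + length (X core)
  ... | yes p = p
  ... | no  many
    with more ← ≰⇒> many
    with a , a∉ ← another (X core) (≤-trans (m≤n+m _ 3) more)
    with b , b∉ ← another (a ∷ X core) (≤-trans (m≤n+m _ 2) more)
    with c , c∉ ← another (b ∷ a ∷ X core) (≤-trans (m≤n+m _ 1) more)
    with d , d∉ ← another (c ∷ b ∷ a ∷ X core) more
    with D , D∈E , () ← killer ([] , (# 0 ∷ # 1 ∷ # 2 ∷ # 3 ∷ []))
           ((((d∉ ∘ here) ∷ (d∉ ∘ there ∘ here) ∷ (d∉ ∘ there ∘ there ∘ here) ∷ [])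
                      ∷ ((c∉ ∘ here) ∷ (c∉ ∘ there ∘ here) ∷ []) ∷ ((b∉ ∘ here) ∷ []) ∷ [] ∷ []) , [])
           ([] , (d∉ ∘ there ∘ there ∘ there ∘ full d) ∷ (c∉ ∘ there ∘ there ∘ full c) ∷ (b∉ ∘ there ∘ full b) ∷ (a∉ ∘ full a) ∷ [])
           four refl []

  -- Two uncovered vertices and a twin pair would make a 4-set that every edge meets in zero or two
  -- vertices.
  one-uncovered : ∀ {d} (core : Core d) → Full core → ∀ {p q} → Twin p q → n ≤ 1 + length (X core)
  one-uncovered core full {p} {q} pq@(p≢q , cp , agree) with n ≤? 1 + length (X core)
  ... | yes p = p
  ... | no  many
    with more ← ≰⇒> many
    with a , a∉ ← another (X core) (≤-trans (m≤n+m _ 1) more)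
    with b , b∉ ← another (a ∷ X core) more
    with D , D∈E , () ← killer (((# 2 , # 3) ∷ []) , (# 0 ∷ # 1 ∷ []))
           ((((b∉ ∘ here) ∷ (λ { refl → b∉ (there (full b cp)) }) ∷ (λ { refl → b∉ (there (full b (proj₁ (proj₂ (twin-sym pq))))) }) ∷ [])
                      ∷ ((λ { refl → a∉ (full a cp) }) ∷ (λ { refl → a∉ (full a (proj₁ (proj₂ (twin-sym pq)))) }) ∷ []) ∷ (p≢q ∷ []) ∷ [] ∷ []) , [])
           (agree ∷ [] , (b∉ ∘ there ∘ full b) ∷ (a∉ ∘ full a) ∷ [])
           four refl []

  -- Starting cores

  Seed : ℕ → Set
  Seed d = ∃[ core ] Anchor (X {d} core)

  plant : ∀ {φ : Vec (Fin n) k} {C : Config k} d τ → Realised φ C → {True (extension? (allFin k) τ C)} →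
          All (λ i → Any (λ j → Twin (lookup φ i) (lookup φ j)) (allFin k)) τ → k ≤ length C + d →
          ∃[ core ] (∀ i → lookup φ i ∈ X {d} core)
  plant {k} {φ} {C} d τ real {ok} twins count
    with core , refl ← extend {d′ = d} empty (allFin k) τ real (toWitness ok) (All.universal (λ _ ()) _)
           (λ i → inj₁ (∈-allFin i)) twins
           (≤-trans (≤-reflexive (trans (+-identityʳ _) (length-allFin _))) count)
    = core , λ i → ∈-++⁺ˡ (∈-map⁺ (lookup φ) (∈-allFin i))

  twin-at : ∀ {φ : Vec (Fin n) k} {C} → Realised φ C → ∀ i j → {True (¬? (i Fin.≟ j))} →
            {True (Any.any? (λ T → lookup T i Bool.≟ true) C)} →
            Agree (lookup φ i) (lookup φ j) → Twin (lookup φ i) (lookup φ j)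
  twin-at real@(uφ , _) i j {i≢j} {cov} agree =
    toWitness i≢j ∘ Unique.lookup-injective uφ i j , twin-covered real i (toWitness cov) , agree

  -- The other two vertices of an edge through `p` and `q` are no twins, as a second pair is
  -- excluded. So `triangle` applies and gives five vertices with three edges.
  seed-one : ∀ {p q} → Twin p q → NoTwoPairs → Seed 2
  seed-one {p} {q} pq@(p≢q , cp , agree) nt
    with A , A∈E , p∈A ← find cp
    with x , y , real ← complete₂ A∈E p≢q p∈A (trans (sym (All.lookup agree A∈E)) p∈A)
    with z , tri ← triangle real agree (λ xy → nt (proj₁ (relabel real (# 2 ∷ # 3 ∷ # 0 ∷ # 1 ∷ []) (four ∷ []))) pq (twin-at real (# 0) (# 1) xy))
    with core , inX ← plant 2 (# 3 ∷ # 4 ∷ []) tri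
           (lose (∈-allFin (# 4)) pq ∷ lose (∈-allFin (# 3)) (twin-sym pq) ∷ []) ≤-refl
    = core , one (inX (# 3)) (inX (# 4)) pq nt

  seed-two : ∀ {p q r s} → Unique (p ∷ q ∷ r ∷ s ∷ []) → Twin p q → Twin r s →
             Realised (p ∷ q ∷ r ∷ s ∷ []) (four ∷ []) → Seed 3
  seed-two u pq rs real
    with core , inX ← plant 3 (# 0 ∷ # 1 ∷ # 2 ∷ # 3 ∷ []) real
           (lose (∈-allFin (# 1)) pq ∷ lose (∈-allFin (# 0)) (twin-sym pq) ∷
            lose (∈-allFin (# 3)) rs ∷ lose (∈-allFin (# 2)) (twin-sym rs) ∷ []) ≤-refl
    = core , two (inX (# 0)) (inX (# 1)) (inX (# 2)) (inX (# 3)) u pq rs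

-- Two twin pairs in the presence of an uncovered vertex

module Isolated {n} (G : Hypergraph4 n) (sat : B4Saturated G) {u : Fin n} where
  open Saturated G sat
  open Growth G sat

  module _ (free : ¬ Covered u) where

    -- Label order: z, x, y, p, q, r, s, u.
    Fan : Config 8
    Fan = edge 0x0134 ∷ edge 0x0234 ∷ edge 0x1234 ∷ edge 0x3456 ∷ []

    -- The 4-set xyzu is blocked by an edge through p, q, a fourth vertex w and one of x, y, z.
    fan-closed : ∀ {z x y p q r s D} → Realised (z ∷ x ∷ y ∷ p ∷ q ∷ r ∷ s ∷ u ∷ []) Fan →
                 Twin p q → Twin r s → D ∈ E → trace (z ∷ x ∷ y ∷ p ∷ q ∷ r ∷ s ∷ u ∷ []) D ≡ points 3 0x034 → Seed 2
    fan-closed {z} {x} {y} {p} {q} {r} {s} real pq@(_ , _ , pq′) rs@(_ , _ , rs′) D∈E eq =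
      let w , real = add₁ real D∈E eq refl
          -- An edge blocking wxpq avoids the twins p, q and contains exactly one of w, x. Then wzpq
          -- or zxpq forces z into it, and it meets the other of these two edges in z alone.
          real = forced ((# 4 , # 5) ∷ (# 6 , # 7) ∷ [] , # 8 ∷ []) (edge 0x0245) real (pq′ ∷ rs′ ∷ [] , free ∷ [])
          real = relabel real (# 0 ∷ # 1 ∷ # 2 ∷ # 3 ∷ # 4 ∷ # 5 ∷ # 6 ∷ # 7 ∷ [])
                   (edge 0x0145 ∷ edge 0x0245 ∷ edge 0x1245 ∷ edge 0x1345 ∷ edge 0x2345 ∷ edge 0x4567 ∷ [])
          -- Eight vertices and six edges: pq joined to five of the six pairs from w, z, x, y, and
          -- pqrs.
          core , inX = plant 2 (# 4 ∷ # 5 ∷ # 6 ∷ # 7 ∷ []) real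
            (lose (∈-allFin (# 5)) pq ∷ lose (∈-allFin (# 4)) (twin-sym pq) ∷
             lose (∈-allFin (# 7)) rs ∷ lose (∈-allFin (# 6)) (twin-sym rs) ∷ []) ≤-refl
      in core , two (inX (# 4)) (inX (# 5)) (inX (# 6)) (inX (# 7))
                    (proj₁ (relabel real (# 4 ∷ # 5 ∷ # 6 ∷ # 7 ∷ []) [])) pq rs

    fan-seed : ∀ {z x y p q r s} → Realised (z ∷ x ∷ y ∷ p ∷ q ∷ r ∷ s ∷ u ∷ []) Fan →
               Twin p q → Twin r s → Seed 2
    fan-seed {z} {x} {y} {p} {q} {r} {s} real pq@(_ , _ , pq′) rs@(_ , _ , rs′) = by-cases
      (killer ((# 3 , # 4) ∷ (# 5 , # 6) ∷ [] , # 7 ∷ []) real (pq′ ∷ rs′ ∷ [] , free ∷ []) (edge 0x0127) refl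
        (points 3 0x034 ∷ points 3 0x134 ∷ points 3 0x234 ∷ []))
      where
      by-cases : ∃[ D ] D ∈ E × trace (z ∷ x ∷ y ∷ p ∷ q ∷ r ∷ s ∷ u ∷ []) D ∈
                   points 3 0x034 ∷ points 3 0x134 ∷ points 3 0x234 ∷ [] → Seed 2
      by-cases (D , D∈E , here eq) = fan-closed real pq rs D∈E eq
      by-cases (D , D∈E , there (here eq)) = fan-closed (relabel real ρ Fan) pq rs D∈E (cong (λ t → map (lookup t) ρ) eq)
        where
        -- `Fan` is symmetric in z, x, y, so exchanging z with x leads back to the first case.
        ρ : Vec (Fin 8) 8
        ρ = # 1 ∷ # 0 ∷ # 2 ∷ # 3 ∷ # 4 ∷ # 5 ∷ # 6 ∷ # 7 ∷ []
      by-cases (D , D∈E , there (there (here eq))) = fan-closed (relabel real ρ Fan) pq rs D∈E (cong (λ t → map (lookup t) ρ) eq)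
        where
        ρ : Vec (Fin 8) 8
        ρ = # 2 ∷ # 1 ∷ # 0 ∷ # 3 ∷ # 4 ∷ # 5 ∷ # 6 ∷ # 7 ∷ []

    -- An edge separating `x` and `y` must contain the twins `p`, `q`, hence has no room for `r`,
    -- `s`. Its fourth vertex z is new, and the third edge of the triangle xyz over pq is forced,
    -- which yields `Fan`.
    fat-seed : ∀ {x y p q r s} → Realised (x ∷ y ∷ p ∷ q ∷ r ∷ s ∷ u ∷ []) (edge 0x0123 ∷ edge 0x2345 ∷ []) →
               Twin p q → Twin r s → ¬ Agree x y → Seed 2
    fat-seed {x} {y} {p} {q} {r} {s} real pq@(_ , _ , pq′) rs@(_ , _ , rs′) ¬xy = by-cases
      (splitter ((# 2 , # 3) ∷ (# 4 , # 5) ∷ [] , # 6 ∷ []) real (pq′ ∷ rs′ ∷ [] , free ∷ []) (# 0) (# 1) ¬xy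
        (points 3 0x023 ∷ points 3 0x123 ∷ []))
      where
      ρ : Vec (Fin 8) 8
      ρ = # 0 ∷ # 1 ∷ # 2 ∷ # 3 ∷ # 4 ∷ # 5 ∷ # 6 ∷ # 7 ∷ []
      by-cases : ∃[ D ] D ∈ E × trace (x ∷ y ∷ p ∷ q ∷ r ∷ s ∷ u ∷ []) D ∈ points 3 0x023 ∷ points 3 0x123 ∷ [] → Seed 2
      by-cases (D , D∈E , here eq) =
        let z , real = add₁ real D∈E eq refl
        in fan-seed (relabel (forced ((# 3 , # 4) ∷ (# 5 , # 6) ∷ [] , # 7 ∷ []) (edge 0x0234) real
             (pq′ ∷ rs′ ∷ [] , free ∷ [])) ρ Fan) pq rs
      by-cases (D , D∈E , there (here eq)) =
        let z , real = add₁ real D∈E eq refl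
        in fan-seed (relabel (forced ((# 3 , # 4) ∷ (# 5 , # 6) ∷ [] , # 7 ∷ []) (edge 0x0134) real
             (pq′ ∷ rs′ ∷ [] , free ∷ [])) ρ Fan) pq rs

    -- The edge `D` has two further vertices. If they are no twins, `fat-seed` applies. Otherwise
    -- there are four twin pairs, and their six unions are edges on eight vertices, which gives
    -- deficit 2.
    pairs-seed : ∀ {w v p q r s D} → let φ = w ∷ v ∷ p ∷ q ∷ r ∷ s ∷ u ∷ [] in
                 Realised φ (edge 0x0123 ∷ edge 0x0145 ∷ edge 0x2345 ∷ []) →
                 Twin w v → Twin p q → Twin r s → D ∈ E → trace φ D ≡ points 2 0x01 → Seed 2
    pairs-seed {w} {v} {p} {q} {r} {s} real wv@(_ , _ , wv′) pq@(_ , _ , pq′) rs@(_ , _ , rs′) D∈E eq =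
      let b , a , real = add₂ real D∈E eq refl in by-cases real (agree? b a)
      where
      by-cases : ∀ {b a} → Realised (b ∷ a ∷ w ∷ v ∷ p ∷ q ∷ r ∷ s ∷ u ∷ [])
                   (edge 0x0123 ∷ edge 0x2345 ∷ edge 0x2367 ∷ edge 0x4567 ∷ []) → Dec (Agree b a) → Seed 2
      by-cases real (no ¬ba) = fat-seed (relabel real (# 0 ∷ # 1 ∷ # 2 ∷ # 3 ∷ # 4 ∷ # 5 ∷ # 8 ∷ []) _) wv pq ¬ba
      by-cases real (yes ba′) =
        let ba = twin-at real (# 0) (# 1) ba′
            l = (# 0 , # 1) ∷ (# 2 , # 3) ∷ (# 4 , # 5) ∷ (# 6 , # 7) ∷ [] , # 8 ∷ []
            law = ba′ ∷ wv′ ∷ pq′ ∷ rs′ ∷ [] , free ∷ []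
            real = forced l (edge 0x0167) (forced l (edge 0x0145) real law) law
            real = relabel real (# 0 ∷ # 1 ∷ # 2 ∷ # 3 ∷ # 4 ∷ # 5 ∷ # 6 ∷ # 7 ∷ [])
              (edge 0x0123 ∷ edge 0x0145 ∷ edge 0x0167 ∷ edge 0x2345 ∷ edge 0x2367 ∷ edge 0x4567 ∷ [])
            core , inX = plant 2 (allFin 8) real
              (lose (∈-allFin (# 1)) ba ∷ lose (∈-allFin (# 0)) (twin-sym ba) ∷
               lose (∈-allFin (# 3)) wv ∷ lose (∈-allFin (# 2)) (twin-sym wv) ∷
               lose (∈-allFin (# 5)) pq ∷ lose (∈-allFin (# 4)) (twin-sym pq) ∷
               lose (∈-allFin (# 7)) rs ∷ lose (∈-allFin (# 6)) (twin-sym rs) ∷ []) ≤-refl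
        in core , two (inX (# 4)) (inX (# 5)) (inX (# 6)) (inX (# 7))
                      (proj₁ (relabel real (# 4 ∷ # 5 ∷ # 6 ∷ # 7 ∷ []) [])) pq rs

    -- The 4-set pqru is blocked by an edge through r, s and two further vertices w, v; if these are twins, the
    -- 4-set of u and one vertex from each of the three pairs is blocked by an edge on one pair.
    isolated-seed : ∀ {p q r s} → Realised (p ∷ q ∷ r ∷ s ∷ u ∷ []) (edge 0x0123 ∷ []) → Twin p q → Twin r s → Seed 2
    isolated-seed {p} {q} {r} {s} real pq@(_ , _ , pq′) rs@(_ , _ , rs′) = second
      (killer ((# 0 , # 1) ∷ (# 2 , # 3) ∷ [] , # 4 ∷ []) real (pq′ ∷ rs′ ∷ [] , free ∷ []) (edge 0x0124) refl
        (points 2 0x23 ∷ []))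
      where
      three-pairs : ∀ {w v} → Realised (w ∷ v ∷ p ∷ q ∷ r ∷ s ∷ u ∷ []) (edge 0x0123 ∷ edge 0x0145 ∷ edge 0x2345 ∷ []) →
                    Twin w v → Seed 2
      three-pairs {w} {v} real wv@(_ , _ , wv′) = by-cases
        (killer ((# 0 , # 1) ∷ (# 2 , # 3) ∷ (# 4 , # 5) ∷ [] , # 6 ∷ []) real (wv′ ∷ pq′ ∷ rs′ ∷ [] , free ∷ [])
          (edge 0x0246) refl (points 2 0x01 ∷ points 2 0x23 ∷ points 2 0x45 ∷ []))
        where
        by-cases : ∃[ D ] D ∈ E × trace (w ∷ v ∷ p ∷ q ∷ r ∷ s ∷ u ∷ []) D ∈
                     points 2 0x01 ∷ points 2 0x23 ∷ points 2 0x45 ∷ [] → Seed 2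
        by-cases (D , D∈E , here eq) = pairs-seed real wv pq rs D∈E eq
        by-cases (D , D∈E , there (here eq)) =
          pairs-seed (relabel real ρ _) pq wv rs D∈E (cong (λ t → map (lookup t) ρ) eq)
          where
          ρ : Vec (Fin 7) 7
          ρ = # 2 ∷ # 3 ∷ # 0 ∷ # 1 ∷ # 4 ∷ # 5 ∷ # 6 ∷ []
        by-cases (D , D∈E , there (there (here eq))) =
          pairs-seed (relabel real ρ _) rs wv pq D∈E (cong (λ t → map (lookup t) ρ) eq)
          where
          ρ : Vec (Fin 7) 7
          ρ = # 4 ∷ # 5 ∷ # 0 ∷ # 1 ∷ # 2 ∷ # 3 ∷ # 6 ∷ []
      third : ∀ {w v} → Realised (w ∷ v ∷ p ∷ q ∷ r ∷ s ∷ u ∷ []) (edge 0x0145 ∷ edge 0x2345 ∷ []) →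
              Dec (Agree w v) → Seed 2
      third real (no ¬wv)  = fat-seed (relabel real (# 0 ∷ # 1 ∷ # 4 ∷ # 5 ∷ # 2 ∷ # 3 ∷ # 6 ∷ []) _) rs pq ¬wv
      third real (yes wv) = three-pairs
        (forced ((# 0 , # 1) ∷ (# 2 , # 3) ∷ (# 4 , # 5) ∷ [] , # 6 ∷ []) (edge 0x0123) real
          (wv ∷ pq′ ∷ rs′ ∷ [] , free ∷ []))
        (twin-at real (# 0) (# 1) wv)
      second : ∃[ D ] D ∈ E × trace (p ∷ q ∷ r ∷ s ∷ u ∷ []) D ∈ points 2 0x23 ∷ [] → Seed 2
      second (D , D∈E , here eq) = let w , v , real = add₂ real D∈E eq refl in third real (agree? w v)

-- Lower bounds on the number of edges

module LowerBounds {n} (G : Hypergraph4 n) (sat : B4Saturated G) where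
  open Saturated G sat
  open Growth G sat
  open Core

  -- The summand 3 is made up of deficit 2 and at most one uncovered vertex.
  seed-bound : ∀ {p q} → Twin p q → Seed 2 → n ≤ 3 + length E
  seed-bound pq (core , anchor)
    with core′ , full , _ ← saturate n core anchor (m≤n+m n _)
    = ≤-trans (one-uncovered core′ full pq) (s≤s (core-bound core′))

  -- A full core now contains every vertex, so the whole summand 3 may be spent on the deficit.
  covered-bound : (∀ v → Covered v) → Seed 3 → n ≤ 3 + length E
  covered-bound all (core , anchor)
    with core′ , full , _ ← saturate n core anchor (m≤n+m n _)
    = ≤-trans (≤-reflexive (sym (length-allFin n)))
        (≤-trans (injection-length (Uniqueᴸ.allFin⁺ n) (λ {v} _ → full v (all v))) (core-bound core′))

  two-pairs-bound : ∀ {p q r s} → Unique (p ∷ q ∷ r ∷ s ∷ []) → Twin p q → Twin r s → n ≤ 3 + length E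
  two-pairs-bound {p} {q} {r} {s} u pq@(_ , cp , pq′) rs@(_ , cr , rs′) = by-cases (Fin.any? (λ v → ¬? (covered? v)))
    where
    real : Realised (p ∷ q ∷ r ∷ s ∷ []) (four ∷ [])
    real = forced ((# 0 , # 1) ∷ (# 2 , # 3) ∷ [] , []) four (u , []) (pq′ ∷ rs′ ∷ [] , [])
    differs : ∀ {v w} → ¬ Covered v → Covered w → v ≢ w
    differs free c refl = free c
    by-cases : Dec (∃[ v ] ¬ Covered v) → n ≤ 3 + length E
    by-cases (no  all)        = covered-bound every (seed-two u pq rs real)
      where
      every : ∀ v → Covered v
      every v with covered? v
      ... | yes c = c
      ... | no ¬c = contradiction (v , ¬c) all
    by-cases (yes (v , free)) = seed-bound pq (Isolated.isolated-seed G sat free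
      (relabel (fresh-realised (differs free cp ∷ differs free (proj₁ (proj₂ (twin-sym pq))) ∷
                                differs free cr ∷ differs free (proj₁ (proj₂ (twin-sym rs))) ∷ []) real)
        (# 1 ∷ # 2 ∷ # 3 ∷ # 4 ∷ # 0 ∷ []) _) pq rs)

  lower-bound : n ≤ 3 + length E
  lower-bound
    with Fin.any? (λ p → Fin.any? λ q → Fin.any? λ r → Fin.any? λ s →
           allPairs? (λ i j → ¬? (i Fin.≟ j)) (p ∷ q ∷ r ∷ s ∷ []) ×-dec twin? p q ×-dec twin? r s)
  ... | yes (p , q , r , s , u , pq , rs) = two-pairs-bound u pq rs
  ... | no  not-two with Fin.any? (λ p → Fin.any? λ q → twin? p q)
  ...   | yes (p , q , pq) = seed-bound pq (seed-one pq λ u pq rs → not-two (_ , _ , _ , _ , u , pq , rs))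
  ...   | no  no-pair
    with core , full , _ ← saturate n empty (none λ u v uv → no-pair (u , v , uv)) (m≤n+m n _)
    -- Here the deficit is 0, which leaves room for three uncovered vertices.
    = ≤-trans (few-uncovered core full) (+-monoʳ-≤ 3 (core-bound core))

  open Search (λ _ → Unit) (λ _ _ _ _ → tt)

  -- Saturation applied to any four vertices yields an edge, whether these form one or are blocked
  -- by one.
  first-edge : 4 ≤ n → ∃[ φ ] Realised {4} φ (four ∷ [])
  first-edge 4≤n
    with a , a∉ ← another [] (≤-trans (s≤s z≤n) 4≤n)
    with b , b∉ ← another (a ∷ []) (≤-trans (s≤s (s≤s z≤n)) 4≤n)
    with c , c∉ ← another (b ∷ a ∷ []) (≤-trans (s≤s (s≤s (s≤s z≤n))) 4≤n)
    with d , d∉ ← another (c ∷ b ∷ a ∷ []) 4≤n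
    with A , A∈E , _ ← killed {φ = d ∷ c ∷ b ∷ a ∷ []}
           (((d∉ ∘ here) ∷ (d∉ ∘ there ∘ here) ∷ (d∉ ∘ there ∘ there ∘ here) ∷ [])
            ∷ ((c∉ ∘ here) ∷ (c∉ ∘ there ∘ here) ∷ []) ∷ ((b∉ ∘ here) ∷ []) ∷ [] ∷ []) four refl
    with v , v∈A ← nonempty A (subst (0 <_) (sym (∣edge∣ A∈E)) (s≤s z≤n))
    with _ , _ , _ , real ← complete₁ A∈E v∈A
    = _ , real

  -- The table starts from a single edge, and the search ends with at least `n` different traces,
  -- which belong to different edges.
  order-bound : ∀ {es q rs} → Valid (order n) (entry 4 (four ∷ []) q rs ∷ es) → 4 ≤ n → n ≤ length E
  order-bound valid 4≤n =
    realise (All.head (valid-sound (order n) (refl , λ _ → tt) valid) (Allⱽ.universal (λ _ → tt) _) (proj₂ (first-edge 4≤n)))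
    where
    realise : Goal (order n) → n ≤ length E
    realise (k , φ , C , _ , (_ , real) , n≤C , uC) with N , refl , N⊆E ← realising-edges real =
      ≤-trans n≤C (≤-trans (≤-reflexive (List.length-map (trace φ) N))
        (injection-length (AllPairs.map (_∘ cong (trace φ)) (AllPairs.map⁻ uC)) (All.lookup N⊆E)))

-- Constructions for the upper bound

open import Data.Nat.Combinatorics using (_C_)

Design : List (Subset n) → Set
Design L = All Is4Set L × Uniqueᴸ L × All (λ A → All (λ B → ∣ A ∩ B ∣ ≢ 1) L) L ×
           (∀ S → Is4Set S → S ∈ L ⊎ Any (λ A → ∣ A ∩ S ∣ ≡ 1) L)

design? : (L : List (Subset n)) → Dec (Design L)
design? L = All.all? (λ A → ∣ A ∣ ≟ 4) L ×-dec unique? _≟ˢ_ L ×-dec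
            All.all? (λ A → All.all? (λ B → ¬? (∣ A ∩ B ∣ ≟ 1)) L) L ×-dec
            all-subsets? (λ S → ∣ S ∣ ≟ 4 →-dec (S ∈? L ⊎-dec Any.any? (λ A → ∣ A ∩ S ∣ ≟ 1) L))

saturated : {L : List (Subset n)} → Design L → Σ[ G ∈ Hypergraph4 n ] (B4Saturated G × e G ≡ length L)
saturated {L = L} (sizes , uL , free , sat) =
  mkHG L sizes uL , ((λ A B A∈L B∈L → All.lookup (All.lookup free A∈L) B∈L) , killing) , refl
  where
  killing : ∀ S → Is4Set S → ¬ (S ∈ L) → Any (λ A → ∣ A ∩ S ∣ ≡ 1) L
  killing S ∣S∣ S∉L with sat S ∣S∣
  ... | inj₁ S∈L = contradiction S∈L S∉L
  ... | inj₂ hit = hit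

subsets : ∀ n → List (Subset n)
subsets zero    = [] ∷ []
subsets (suc n) = List.map (true ∷_) (subsets n) ++ List.map (false ∷_) (subsets n)

four-subsets : ∀ n → List (Subset n)
four-subsets n = List.filter (λ S → ∣ S ∣ ≟ 4) (subsets n)

-- On at most six vertices two 4-sets share at least two vertices. Hence nothing is ever blocked,
-- and the complete hypergraph is the only saturated one.
Crowded : ℕ → Set
Crowded n = Uniqueᴸ (four-subsets n) × length (four-subsets n) ≡ n C 4 ×
            (∀ S → Is4Set S → S ∈ four-subsets n) ×
            All (λ A → All (λ B → ∣ A ∩ B ∣ ≢ 1) (four-subsets n)) (four-subsets n)

crowded? : ∀ n → Dec (Crowded n)
crowded? n = unique? _≟ˢ_ (four-subsets n) ×-dec length (four-subsets n) ≟ n C 4 ×-dec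
             all-subsets? (λ S → ∣ S ∣ ≟ 4 →-dec S ∈? four-subsets n) ×-dec
             All.all? (λ A → All.all? (λ B → ¬? (∣ A ∩ B ∣ ≟ 1)) (four-subsets n)) (four-subsets n)

complete-sat : Crowded n → IsSat4B4 n (n C 4)
complete-sat {n} (u , count , all , free) =
  subst (λ k → Σ[ G ∈ Hypergraph4 n ] (B4Saturated G × e G ≡ k)) count
    (saturated (All.all-filter (λ S → ∣ S ∣ ≟ 4) (subsets n) , u , free , λ S ∣S∣ → inj₁ (all S ∣S∣))) ,
  lower
  where
  lower : ∀ G → B4Saturated G → n C 4 ≤ e G
  lower G (_ , sat) = ≤-trans (≤-reflexive (sym count)) (injection-length u edge∈)
    where
    edge∈ : ∀ {S} → S ∈ four-subsets n → S ∈ edges G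
    edge∈ {S} S∈ with S ∈? edges G | All.lookup (All.all-filter (λ S → ∣ S ∣ ≟ 4) (subsets n)) S∈
    ... | yes S∈G | _   = S∈G
    ... | no  S∉G | ∣S∣ with A , A∈G , hit ← find (sat S ∣S∣ S∉G) =
      contradiction hit (All.lookup (All.lookup free (all A (All.lookup (uniform G) A∈G))) S∈)

∣++∣ : ∀ (A : Subset m) (B : Subset t) → ∣ A ++ⱽ B ∣ ≡ ∣ A ∣ + ∣ B ∣
∣++∣ []          B = refl
∣++∣ (true  ∷ A) B = cong suc (∣++∣ A B)
∣++∣ (false ∷ A) B = ∣++∣ A B

∣++∩++∣ : ∀ (A B : Subset m) (S T : Subset t) → ∣ (A ++ⱽ S) ∩ (B ++ⱽ T) ∣ ≡ ∣ A ∩ B ∣ + ∣ S ∩ T ∣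
∣++∩++∣ A B S T = trans (cong ∣_∣ (zipWith-++ _∧_ A S B T)) (∣++∣ (A ∩ B) (S ∩ T))

∣∅∩∣ : ∀ (T : Subset t) → ∣ ∅ ∩ T ∣ ≡ 0
∣∅∩∣ {t} T = trans (cong ∣_∣ (∩-zeroˡ T)) (∣⊥∣≡0 t)

∣⁅⁆∩∣ : ∀ i (T : Subset t) → ∣ ⁅ i ⁆ ∩ T ∣ ≡ ∣ lookup T i ∷ [] ∣
∣⁅⁆∩∣ zero    (true  ∷ T) = cong suc (∣∅∩∣ T)
∣⁅⁆∩∣ zero    (false ∷ T) = ∣∅∩∣ T
∣⁅⁆∩∣ (suc i) (b ∷ T)     = ∣⁅⁆∩∣ i T

nonfull : ∀ (T : Subset t) → ∣ T ∣ < t → ∃[ i ] lookup T i ≡ false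
nonfull (false ∷ T) _       = zero , refl
nonfull (true  ∷ T) (s≤s p) = let i , eq = nonfull T p in suc i , eq

size-0 : ∀ (T : Subset t) → ∣ T ∣ ≡ 0 → T ≡ ∅
size-0 []          _ = refl
size-0 (false ∷ T) p = cong (false ∷_) (size-0 T p)

size-1 : ∀ (T : Subset t) → ∣ T ∣ ≡ 1 → ∃[ i ] T ≡ ⁅ i ⁆
size-1 (true  ∷ T) p = zero , cong (true ∷_) (size-0 T (suc-injective p))
size-1 (false ∷ T) p = let i , eq = size-1 T p in suc i , cong (false ∷_) eq

-- The last component lists, for a 4-set meeting the base in B, what blocks it once petals K ∪ {x} are added:
-- an edge of the base, a petal with x in the 4-set, or a petal with x outside it.
Flower : Subset m → List (Subset m) → Set
Flower K L =
  ∣ K ∣ ≡ 3 × All Is4Set L × Uniqueᴸ L ×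
  All (λ A → ∣ A ∩ K ∣ ≢ 1) L × All (λ A → All (λ B → ∣ A ∩ B ∣ ≢ 1) L) L ×
  (∀ B → ∣ B ∣ ≤ 4 → Any (λ A → ∣ A ∩ B ∣ ≡ 1) L ⊎ B ∈ L ⊎ (∣ K ∩ B ∣ ≡ 0 × ∣ B ∣ < 4) ⊎
                     (∣ K ∩ B ∣ ≡ 1 × 3 ≤ ∣ B ∣) ⊎ B ≡ K)

flower? : ∀ (K : Subset m) L → Dec (Flower K L)
flower? K L =
  ∣ K ∣ ≟ 3 ×-dec All.all? (λ A → ∣ A ∣ ≟ 4) L ×-dec unique? _≟ˢ_ L ×-dec
  All.all? (λ A → ¬? (∣ A ∩ K ∣ ≟ 1)) L ×-dec All.all? (λ A → All.all? (λ B → ¬? (∣ A ∩ B ∣ ≟ 1)) L) L ×-dec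
  all-subsets? (λ B → ∣ B ∣ ≤? 4 →-dec
    (Any.any? (λ A → ∣ A ∩ B ∣ ≟ 1) L ⊎-dec B ∈? L ⊎-dec (∣ K ∩ B ∣ ≟ 0 ×-dec ∣ B ∣ <? 4) ⊎-dec
    (∣ K ∩ B ∣ ≟ 1 ×-dec 3 ≤? ∣ B ∣) ⊎-dec B ≟ˢ K))

with-petals : Subset m → List (Subset m) → ∀ t → List (Subset (m + t))
with-petals K L t = List.map (_++ⱽ ∅) L ++ List.map (λ i → K ++ⱽ ⁅ i ⁆) (allFin t)

-- Two petals share the three vertices of `K`, and a base edge meets a petal only within `K`, so no
-- bow tie arises. Each 4-set is treated according to its part `B` in the base.
petals-design : ∀ {K : Subset m} {L} → Flower K L → 2 ≤ t → Design (with-petals K L t)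
petals-design {m} {t} {K} {L} (∣K∣ , sizes , uL , K-free , free , sat) 2≤t =
  All.++⁺ (All.map⁺ (All.map (λ {A} → base-size {A}) sizes)) (All.map⁺ (All.universal petal-size (allFin t))) ,
  Uniqueᴸ.++⁺ (Uniqueᴸ.map⁺ (λ {A} {B} → ++-injectiveˡ A B) uL)
    (Uniqueᴸ.map⁺ (λ {i} {j} eq → ⁅⁆-injective (++-injectiveʳ K K eq)) (Uniqueᴸ.allFin⁺ t)) disjoint ,
  All.++⁺ (All.map⁺ (All.zipWith (λ { {A} (frees , K-free) → All.++⁺
              (All.map⁺ (All.map (λ {B} → base-base A B) frees)) (All.map⁺ (All.universal (λ i → base-petal A i K-free) _)) }) (free , K-free)))
          (All.map⁺ (All.universal (λ i → All.++⁺
              (All.map⁺ (All.map (λ {A} f → base-petal A i f ∘ trans (cong ∣_∣ (∩-comm (A ++ⱽ ∅) (K ++ⱽ ⁅ i ⁆)))) K-free))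
              (All.map⁺ (All.universal (petal-petal i) _))) _)) ,
  killing
  where
  petal : Fin t → Subset (m + t)
  petal i = K ++ⱽ ⁅ i ⁆
  base-size : ∀ {A : Subset m} → ∣ A ∣ ≡ 4 → ∣ A ++ⱽ ∅ {t} ∣ ≡ 4
  base-size {A} ∣A∣ = trans (∣++∣ A ∅) (trans (cong₂ _+_ ∣A∣ (∣⊥∣≡0 t)) refl)
  petal-size : ∀ i → ∣ petal i ∣ ≡ 4
  petal-size i = trans (∣++∣ K ⁅ i ⁆) (cong₂ _+_ ∣K∣ (∣⁅x⁆∣≡1 i))
  ⁅⁆-injective : ∀ {i j : Fin t} → ⁅ i ⁆ ≡ ⁅ j ⁆ → i ≡ j
  ⁅⁆-injective {i} eq = x∈⁅y⁆⇒x≡y _ (subst (i ∈ˢ_) eq (x∈⁅x⁆ i))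
  disjoint : ∀ {A} → ¬ (A ∈ List.map (_++ⱽ ∅) L × A ∈ List.map petal (allFin t))
  disjoint (A∈ , A∈′) with B , _ , refl ← ∈-map⁻ (_++ⱽ ∅) A∈ | i , _ , eq ← ∈-map⁻ petal A∈′
    with () ← trans (sym (∣⊥∣≡0 t)) (trans (cong ∣_∣ (++-injectiveʳ B K eq)) (∣⁅x⁆∣≡1 i))
  base-on : ∀ (A B : Subset m) T → ∣ (A ++ⱽ ∅ {t}) ∩ (B ++ⱽ T) ∣ ≡ ∣ A ∩ B ∣
  base-on A B T = trans (∣++∩++∣ A B ∅ T) (trans (cong (∣ A ∩ B ∣ +_) (∣∅∩∣ T)) (+-identityʳ _))
  petal-on : ∀ i (B : Subset m) T → ∣ petal i ∩ (B ++ⱽ T) ∣ ≡ ∣ K ∩ B ∣ + ∣ lookup T i ∷ [] ∣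
  petal-on i B T = trans (∣++∩++∣ K B ⁅ i ⁆ T) (cong (∣ K ∩ B ∣ +_) (∣⁅⁆∩∣ i T))
  base-base : ∀ A B → ∣ A ∩ B ∣ ≢ 1 → ∣ (A ++ⱽ ∅) ∩ (B ++ⱽ ∅) ∣ ≢ 1
  base-base A B f = f ∘ trans (sym (base-on A B ∅))
  base-petal : ∀ A i → ∣ A ∩ K ∣ ≢ 1 → ∣ (A ++ⱽ ∅) ∩ petal i ∣ ≢ 1
  base-petal A i f = f ∘ trans (sym (base-on A K ⁅ i ⁆))
  petal-petal : ∀ i j → ∣ petal i ∩ petal j ∣ ≢ 1
  petal-petal i j eq with () ← trans (sym (trans (petal-on i K ⁅ j ⁆) (cong (_+ _) (trans (cong ∣_∣ (∩-idem K)) ∣K∣)))) eq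
  killing : ∀ S → Is4Set S → S ∈ with-petals K L t ⊎ Any (λ A → ∣ A ∩ S ∣ ≡ 1) (with-petals K L t)
  killing S ∣S∣ with B , T , refl ← splitAt m S = by-cases (sat B (≤-trans (m≤m+n _ _) (≤-reflexive total)))
    where
    total : ∣ B ∣ + ∣ T ∣ ≡ 4
    total = trans (sym (∣++∣ B T)) ∣S∣
    via-petal : ∀ i → ∣ K ∩ B ∣ + ∣ lookup T i ∷ [] ∣ ≡ 1 → Any (λ A → ∣ A ∩ (B ++ⱽ T) ∣ ≡ 1) (with-petals K L t)
    via-petal i eq = lose (∈-++⁺ʳ (List.map (_++ⱽ ∅) L) (∈-map⁺ petal (∈-allFin i))) (trans (petal-on i B T) eq)
    by-cases : Any (λ A → ∣ A ∩ B ∣ ≡ 1) L ⊎ B ∈ L ⊎ (∣ K ∩ B ∣ ≡ 0 × ∣ B ∣ < 4) ⊎ (∣ K ∩ B ∣ ≡ 1 × 3 ≤ ∣ B ∣) ⊎ B ≡ K →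
               B ++ⱽ T ∈ with-petals K L t ⊎ Any (λ A → ∣ A ∩ (B ++ⱽ T) ∣ ≡ 1) (with-petals K L t)
    by-cases (inj₁ hit) = inj₂ (Any.++⁺ˡ (Any.map⁺ (Any.map (λ {A} eq → trans (base-on A B T) eq) hit)))
    by-cases (inj₂ (inj₁ B∈L)) = inj₁ (∈-++⁺ˡ (subst (λ T → B ++ⱽ T ∈ List.map (_++ⱽ ∅) L) (sym T≡∅) (∈-map⁺ (_++ⱽ ∅) B∈L)))
      where
      T≡∅ : T ≡ ∅
      T≡∅ = size-0 T (+-cancelˡ-≡ 4 _ _ (trans (cong (_+ ∣ T ∣) (sym (All.lookup sizes B∈L))) total))
    by-cases (inj₂ (inj₂ (inj₁ (K∩B , B<4)))) = inj₂ (via-petal i (cong₂ (λ c b → c + ∣ b ∷ [] ∣) K∩B i∈T))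
      where
      T>0 : 0 < ∣ T ∣
      T>0 = +-cancelˡ-< (∣ B ∣) 0 (∣ T ∣) (subst₂ _<_ (sym (+-identityʳ _)) (sym total) B<4)
      i = proj₁ (nonempty T T>0)
      i∈T = proj₂ (nonempty T T>0)
    by-cases (inj₂ (inj₂ (inj₂ (inj₁ (K∩B , 3≤B))))) = inj₂ (via-petal i (cong₂ (λ c b → c + ∣ b ∷ [] ∣) K∩B i∉T))
      where
      T<t : ∣ T ∣ < t
      -- At most one vertex of the 4-set lies outside the base, so among two or more petal vertices
      -- one is not in the 4-set.
      T<t = ≤-trans (s≤s (+-cancelˡ-≤ 3 (∣ T ∣) 1 (≤-trans (+-monoˡ-≤ (∣ T ∣) 3≤B) (≤-reflexive total)))) 2≤t
      i = proj₁ (nonfull T T<t)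
      i∉T = proj₂ (nonfull T T<t)
    by-cases (inj₂ (inj₂ (inj₂ (inj₂ refl))))
      with i , refl ← size-1 T (+-cancelˡ-≡ 3 _ _ (trans (cong (_+ ∣ T ∣) (sym ∣K∣)) total))
      = inj₁ (∈-++⁺ʳ (List.map (_++ⱽ ∅) L) (∈-map⁺ petal (∈-allFin i)))

with-petals-length : ∀ (K : Subset m) L t → length (with-petals K L t) ≡ length L + t
with-petals-length K L t = trans (List.length-++ (List.map (_++ⱽ ∅) L))
  (cong₂ _+_ (List.length-map (_++ⱽ ∅) L) (trans (List.length-map _ (allFin t)) (length-allFin t)))

-- Small explicit hypergraphs

-- Complements of the lines of the Fano plane.
design-7 : List (Subset 7)
design-7 = List.map edge (0x0126 ∷ 0x0134 ∷ 0x0235 ∷ 0x0456 ∷ 0x1245 ∷ 0x1356 ∷ 0x2346 ∷ [])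

design-8 : List (Subset 8)
design-8 = List.map edge (0x0147 ∷ 0x1234 ∷ 0x1245 ∷ 0x1246 ∷ 0x1345 ∷ 0x1346 ∷ 0x1456 ∷ 0x2356 ∷ [])

-- A single edge and the complete hypergraph on five vertices.
design-9 : List (Subset 9)
design-9 = List.map edge (0x0123 ∷ 0x4567 ∷ 0x4568 ∷ 0x4578 ∷ 0x4678 ∷ 0x5678 ∷ [])

-- Two pairs 04, 18 forming an edge, each pair completed to an edge by every two vertices of a triple.
design-10 : List (Subset 10)
design-10 = List.map edge (0x0148 ∷ 0x0457 ∷ 0x0459 ∷ 0x0479 ∷ 0x1238 ∷ 0x1268 ∷ 0x1368 ∷ [])

-- A single edge and the Fano complement, of which 123 is a line.
design-11 : List (Subset 11)
design-11 = List.map edge (0x0126 ∷ 0x0134 ∷ 0x0235 ∷ 0x0456 ∷ 0x1245 ∷ 0x1356 ∷ 0x2346 ∷ 0x789a ∷ [])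

-- As for design-10, with a third pair 45 that has no triple.
design-12 : List (Subset 12)
design-12 = List.map edge (0x0123 ∷ 0x0145 ∷ 0x2345 ∷ 0x0167 ∷ 0x0168 ∷ 0x0178 ∷ 0x239a ∷ 0x239b ∷ 0x23ab ∷ [])

abstract
  flower-11 : Flower (points 3 0x123) design-11
  flower-11 = from-yes (flower? (points 3 0x123) design-11)

  is-design-7 : Design design-7
  is-design-7 = from-yes (design? design-7)

  is-design-8 : Design design-8
  is-design-8 = from-yes (design? design-8)

  is-design-9 : Design design-9
  is-design-9 = from-yes (design? design-9)

  is-design-10 : Design design-10
  is-design-10 = from-yes (design? design-10)

  is-design-11 : Design design-11
  is-design-11 = from-yes (design? design-11)

  is-design-12 : Design design-12
  is-design-12 = from-yes (design? design-12)

  crowded : ∀ n → 1 ≤ n → n ≤ 6 → Crowded n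
  crowded 1 _ _ = from-yes (crowded? 1)
  crowded 2 _ _ = from-yes (crowded? 2)
  crowded 3 _ _ = from-yes (crowded? 3)
  crowded 4 _ _ = from-yes (crowded? 4)
  crowded 5 _ _ = from-yes (crowded? 5)
  crowded 6 _ _ = from-yes (crowded? 6)
  crowded (suc (suc (suc (suc (suc (suc (suc _))))))) _ (s≤s (s≤s (s≤s (s≤s (s≤s (s≤s ()))))))

-- Assembly of the three ranges

n-3-bound : ∀ {n} (G : Hypergraph4 n) → B4Saturated G → n ∸ 3 ≤ e G
n-3-bound {n} G sat = m≤n+o⇒m∸n≤o n 3 (LowerBounds.lower-bound G sat)

petals-example : ∀ t → Σ[ G ∈ Hypergraph4 (13 + t) ] (B4Saturated G × e G ≡ 10 + t)
petals-example t = subst (λ k → Σ[ G ∈ Hypergraph4 (13 + t) ] (B4Saturated G × e G ≡ k))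
  -- The base has 11 vertices and 8 edges, and `petals-design` demands at least two petals; hence
  -- the family begins with 13 vertices and 10 edges.
  (with-petals-length (points 3 0x123) design-11 (2 + t))
  (saturated (petals-design flower-11 (s≤s (s≤s z≤n))))

theorem2p3 : ((n : ℕ) → 1 ≤ n → n ≤ 6 → IsSat4B4 n (n C 4))
    × ((n : ℕ) → 7 ≤ n → n ≤ 8 → IsSat4B4 n n)
    × ((n : ℕ) → n ≥ 9 → IsSat4B4 n (n ∸ 3))
theorem2p3 = (λ n 1≤n n≤6 → complete-sat (crowded n 1≤n n≤6)) , middle , large
  where
  middle : (n : ℕ) → 7 ≤ n → n ≤ 8 → IsSat4B4 n n
  middle n 7≤n n≤8 with m≤n⇒∃[o]m+o≡n 7≤n
  ... | 0 , refl = saturated is-design-7 ,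
    λ G sat → LowerBounds.order-bound G sat order-7-valid (s≤s (s≤s (s≤s (s≤s z≤n))))
  ... | 1 , refl = saturated is-design-8 ,
    λ G sat → LowerBounds.order-bound G sat order-8-valid (s≤s (s≤s (s≤s (s≤s z≤n))))
  middle n 7≤n (s≤s (s≤s (s≤s (s≤s (s≤s (s≤s (s≤s (s≤s ())))))))) | suc (suc _) , refl

  example : ∀ m → Σ[ G ∈ Hypergraph4 (9 + m) ] (B4Saturated G × e G ≡ 6 + m)
  example 0 = saturated is-design-9
  example 1 = saturated is-design-10
  example 2 = saturated is-design-11
  example 3 = saturated is-design-12
  example (suc (suc (suc (suc m)))) = petals-example m

  large : (n : ℕ) → n ≥ 9 → IsSat4B4 n (n ∸ 3)
  large n n≥9 with m , refl ← m≤n⇒∃[o]m+o≡n n≥9 = example m , n-3-bound
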